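{- The $\mathbb Z_{(2)}$-module $\Delta$ is stable under each of the operators $e_0,e_1,f_0,f_1$ on $R$: for every $v\in\Delta$ one has $e_0v,\ e_1v,\ f_0v,\ f_1v\in\Delta$.
   Context: Let $R=\mathbb C[p_1,p_3,p_5,\ldots]$ be the polynomial ring in variables $p_k$ indexed by odd positive integers $k$ (this is the basic representation of the affine Lie algebra $\widehat{\mathfrak{sl}_2}$, realized on polynomials). Define operators on $R$: $\alpha_k^*$ = multiplication by $p_k$, and $\alpha_k=k\,\partial/\partial p_k$, for odd $k\ge1$; and operators $A_j$ ($j\in\mathbb Z$) by the identity of formal series in $z$ $$\sum_{j\in\mathbb Z} z^{ -j}A_j=\frac12\exp\Big(-2\sum_{k\ge1\text{ odd}}\frac{p_k}{k}z^k\Big)\exp\Big(2\sum_{k\ge1\text{ odd}}\frac{\partial}{\partial p_k}z^{ -k}\Big)$$ (each coefficient is a well-defined operator on $R$ since it acts on any polynomial through finitely many nonzero terms). The Chevalley generators act by $$e_0=\tfrac12(\alpha_1+A_1),\quad e_1=\tfrac12(\alpha_1-A_1),\quad f_0=\tfrac12(\alpha_1^*-A_{ -1}),\quad f_1=\tfrac12(\alpha_1^*+A_{ -1}).$$ Let $\mathbb Z_{(2)}=\{a/b: a,b\in\mathbb Z,\ b\text{ odd}\}$ and $\Delta=\mathbb Z_{(2)}[p_1,2p_3,4p_5,\ldots]=\mathbb Z_{(2)}[2^kp_{2k+1}:k\ge0]\subset R$. -}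

module Defs where

-- Polynomials in the variables p_1, p_3, p_5, ... with rational coefficients.
-- A monomial is a list of exponents: index i ↦ exponent of p_(2i+1)
-- (trailing zeros are irrelevant).  A polynomial is a finite formal sum of
-- (coefficient , monomial) terms; two polynomials are equal (_≈_) when all
-- their coefficients agree.

open import Data.Nat as ℕ using (ℕ; zero; suc)
open import Data.Integer as ℤ using (ℤ; +_; -[1+_])
open import Data.Rational as ℚ using (ℚ; 0ℚ; 1ℚ; ½; _/_)
open import Data.List as L using (List; []; _∷_; _++_; map; concatMap; filter; foldr; applyUpTo)
import Data.List.Properties as LP
open import Data.Product using (_×_; _,_; Σ; proj₁; proj₂)
open import Data.Bool using (Bool; true; false; if_then_else_)
open import Relation.Nullary using (¬_; does)
open import Relation.Binary.PropositionalEquality using (_≡_)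
open import Data.Nat.Divisibility using (_∣_)

Mono : Set
Mono = List ℕ

Poly : Set
Poly = List (ℚ × Mono)

normMono : Mono → Mono
normMono [] = []
normMono (e ∷ m) with normMono m
... | [] = if does (e ℕ.≟ 0) then [] else e ∷ []
... | r ∷ rs = e ∷ r ∷ rs

sameMono : Mono → Mono → Bool
sameMono m m' = does (LP.≡-dec ℕ._≟_ (normMono m) (normMono m'))

coeff : Poly → Mono → ℚ
coeff P m = foldr (λ t acc → if sameMono (proj₂ t) m then proj₁ t ℚ.+ acc else acc) 0ℚ P

_≈_ : Poly → Poly → Set
P ≈ Q = ∀ (m : Mono) → coeff P m ≡ coeff Q m

addMono : Mono → Mono → Mono
addMono [] m' = m'
addMono (e ∷ m) [] = e ∷ m
addMono (e ∷ m) (e' ∷ m') = (e ℕ.+ e') ∷ addMono m m'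

scale : ℚ → Poly → Poly
scale c = map (λ t → (c ℚ.* proj₁ t , proj₂ t))

_⊕_ : Poly → Poly → Poly
P ⊕ Q = P ++ Q

_⊗_ : Poly → Poly → Poly
P ⊗ Q = concatMap (λ s → map (λ t → (proj₁ s ℚ.* proj₁ t , addMono (proj₂ s) (proj₂ t))) Q) P

sumPoly : List Poly → Poly
sumPoly = foldr _⊕_ []

varMono : ℕ → Mono
varMono zero = 1 ∷ []
varMono (suc i) = 0 ∷ varMono i

var : ℕ → Poly
var i = (1ℚ , varMono i) ∷ []

expo : Mono → ℕ → ℕ
expo [] i = 0
expo (e ∷ m) zero = e
expo (e ∷ m) (suc i) = expo m i

decAt : Mono → ℕ → Mono
decAt [] i = []
decAt (e ∷ m) zero = (e ℕ.∸ 1) ∷ m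
decAt (e ∷ m) (suc i) = e ∷ decAt m i

∂ : ℕ → Poly → Poly
∂ i = concatMap (λ t → dterm (proj₁ t) (proj₂ t) (expo (proj₂ t) i))
  where
  dterm : ℚ → Mono → ℕ → Poly
  dterm c m zero = []
  dterm c m (suc e) = ((c ℚ.* ((+ suc e) / 1)) , decAt m i) ∷ []

∂^ : ℕ → ℕ → Poly → Poly
∂^ i zero P = P
∂^ i (suc n) P = ∂ i (∂^ i n P)

∂multi : ℕ → Mono → Poly → Poly
∂multi i [] P = P
∂multi i (n ∷ m) P = ∂^ i n (∂multi (suc i) m P)

powℚ : ℚ → ℕ → ℚ
powℚ q zero = 1ℚ
powℚ q (suc n) = q ℚ.* powℚ q n

invFact : ℕ → ℚ
invFact zero = 1ℚ
invFact (suc n) = ((+ 1) / suc n) ℚ.* invFact n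

weightFrom : ℕ → Mono → ℕ
weightFrom i [] = 0
weightFrom i (e ∷ m) = (suc (2 ℕ.* i)) ℕ.* e ℕ.+ weightFrom (suc i) m

weight : Mono → ℕ
weight = weightFrom 0

vecs : ℕ → ℕ → List Mono
vecs zero B = [] ∷ []
vecs (suc L) B = concatMap (λ e → map (e ∷_) (vecs L B)) (applyUpTo (λ x → x) (suc B))

oddPartitions : ℕ → List Mono
oddPartitions n = filter (λ m → weight m ℕ.≟ n) (vecs n n)

-- coefficient of z^a in exp(-2 Σ_{k odd} p_k z^k / k)
hFactor : ℕ → Mono → ℚ
hFactor i [] = 1ℚ
hFactor i (e ∷ m) = powℚ (-[1+ 1 ] / suc (2 ℕ.* i)) e ℚ.* invFact e ℚ.* hFactor (suc i) m

hPoly : ℕ → Poly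
hPoly a = map (λ m → (hFactor 0 m , m)) (oddPartitions a)

-- coefficient of z^(-b) in exp(2 Σ_{k odd} ∂/∂p_k z^(-k)), applied to P
dFactor : Mono → ℚ
dFactor [] = 1ℚ
dFactor (e ∷ m) = powℚ ((+ 2) / 1) e ℚ.* invFact e ℚ.* dFactor m

DOp : ℕ → Poly → Poly
DOp b P = sumPoly (map (λ m → scale (dFactor m) (∂multi 0 m P)) (oddPartitions b))

maxWeight : Poly → ℕ
maxWeight = foldr (λ t acc → weight (proj₂ t) ℕ.⊔ acc) 0

-- A_j P = ½ Σ_{a - b = -j} hPoly a · DOp b P ; DOp b P = 0 for b > maxWeight P
termA : ℤ → Poly → ℕ → Poly
termA j P b with (+ b) ℤ.- j
... | + a = hPoly a ⊗ DOp b P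
... | -[1+ _ ] = []

A : ℤ → Poly → Poly
A j P = scale ½ (sumPoly (map (termA j P) (applyUpTo (λ x → x) (suc (maxWeight P)))))

α₁ : Poly → Poly
α₁ = ∂ 0

α₁* : Poly → Poly
α₁* P = var 0 ⊗ P

-_ₚ : Poly → Poly
-_ₚ = scale (ℚ.- 1ℚ)

e₀ e₁ f₀ f₁ : Poly → Poly
e₀ P = scale ½ (α₁ P ⊕ A (+ 1) P)
e₁ P = scale ½ (α₁ P ⊕ (- A (+ 1) P ₚ))
f₀ P = scale ½ (α₁* P ⊕ (- A (-[1+ 0 ]) P ₚ))
f₁ P = scale ½ (α₁* P ⊕ A (-[1+ 0 ]) P)

Zloc2 : ℚ → Set
Zloc2 q = ¬ (2 ∣ ℚ.denominatorℕ q)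

-- substitution p_(2i+1) ↦ 2^i p_(2i+1)
twistFrom : ℕ → Mono → ℚ
twistFrom i [] = 1ℚ
twistFrom i (e ∷ m) = powℚ (powℚ ((+ 2) / 1) i) e ℚ.* twistFrom (suc i) m

twist : Poly → Poly
twist = map (λ t → (proj₁ t ℚ.* twistFrom 0 (proj₂ t) , proj₂ t))

-- Δ = ℤ_(2)[p_1, 2p_3, 4p_5, ...]: v = q(p_1, 2p_3, 4p_5, ...) for some
-- polynomial q with ℤ_(2) coefficients
InΔ : Poly → Set
InΔ v = Σ Poly (λ q → (∀ (m : Mono) → Zloc2 (coeff q m)) × (twist q ≈ v))

{-# OPTIONS --safe #-}
module Submission where

-- Put x_i = 2^i p_(2i+1).  The second exponential shifts x_i by 2^(i+1) z^-(2i+1), so for b > 0 the coefficient of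
-- z^-b maps Δ into 2^(⌊b/2⌋+1) Δ.  The coefficient h_a of z^a in the first exponential consists of monomials
-- Π (-2 x_i / (2^i (2i+1)))^e / e!; as 2^e/e! is even at 2 for e > 0, for a > 0 it lies in 2^(1-⌊(a-1)/2⌋) Δ.
-- Hence for a, b > 0 and a = b ± 1 the product of the two lies in 4Δ, which absorbs both factors ½ in the operators.
-- The terms left over are b = 1, a = 0 in A_1 and a = 1, b = 0 in A_(-1); they equal α₁ and -α₁*, which
-- either double or cancel the α-part of the operator.

open import Defs
open import Data.Bool using (true; false; if_then_else_; not)
open import Data.Bool.Properties using (T?)
open import Data.Integer as ℤ using (ℤ; +_; -[1+_]; ∣_∣)
import Data.Integer.Properties as ℤ
open import Data.List using (List; []; _∷_; _++_; map; filter; foldr; applyUpTo; length)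
open import Data.List.Relation.Unary.All using (All; []; _∷_)
import Data.List.Properties as List
import Data.List.Relation.Unary.All as All
import Data.List.Relation.Unary.All.Properties as All
open import Data.Nat as ℕ using (ℕ; zero; suc; _≤_; _<_; s≤s; _!; z<s)
open import Data.Nat.Combinatorics using ([n∸k]!k!∣n!)
open import Data.Nat.Coprimality as Coprime using (Coprime; coprime-divisor)
open import Data.Nat.Divisibility using (_∣_; divides; ∣-trans; m∣m*n; ∣m+n∣m⇒∣n; ∣1⇒≡1)
open import Data.Nat.Induction using (<-rec)
open import Data.Nat.ListAction using (sum)
open import Data.Nat.Primality using (euclidsLemma; prime[2])
import Data.Nat.Properties as ℕ
open import Data.Nat.Solver using () renaming (module +-*-Solver to ℕSolver)
open import Data.Product using (_×_; _,_; Σ; proj₁; proj₂)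
open import Data.Rational as ℚ using (ℚ; mkℚ; 0ℚ; 1ℚ; ½; _/_; fromℚᵘ; ↥_; ↧ₙ_)
import Data.Rational.Properties as ℚ
open import Data.Rational.Solver using (module +-*-Solver)
open import Data.Rational.Unnormalised as ℚᵘ using (mkℚᵘ; *≡*)
import Data.Rational.Unnormalised.Properties as ℚᵘ
open import Data.Sum using (_⊎_; inj₁; inj₂; [_,_]′)
open import Function using (_∘_)
open import Relation.Nullary using (¬_; does; yes; Dec)
open import Relation.Nullary.Decidable using (dec-true)
open import Relation.Binary.PropositionalEquality

open import Algebra.Properties.CommutativeSemigroup ℕ.+-commutativeSemigroup using () renaming (interchange to +-interchange)
open +-*-Solver using (solve; _:=_; _:*_; _:+_)
open ≡-Reasoning
module ≤ = ℕ.≤-Reasoning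

-- The two exponentials cannot be treated separately. Already h_5 contains -2 p_5 / 5, which lies
-- outside Δ, where p_5 needs a coefficient divisible by 4. Only the coupling of a and b repairs
-- this, so integrality is measured throughout relative to a scalar s that may be a positive or a
-- negative power of 2. A second obstacle is the encoding. Membership in Δ is a condition on
-- coefficients, whereas the operators act on lists of terms, in which non-integral terms may
-- cancel. The given v is therefore replaced by an equal list X whose single terms lie in Δ, and
-- integrality is tracked term by term. This requires the operators to respect equality. For `A`
-- that is not evident, since its sum is cut off at the `maxWeight` of the list; the cutoff of v is
-- kept while X is put into the summands.

private variable
  m n : Mono
  P Q R : Poly
  p q r s : ℚ

-- Rational arithmetic and the ring ℤ₍₂₎.

fromℚᵘ-homo-* : ∀ x y → fromℚᵘ x ℚ.* fromℚᵘ y ≡ fromℚᵘ (x ℚᵘ.* y)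
fromℚᵘ-homo-* x y = ℚ.toℚᵘ-injective (ℚᵘ.≃-trans (ℚ.toℚᵘ-homo-* (fromℚᵘ x) (fromℚᵘ y))
  (ℚᵘ.≃-trans (ℚᵘ.*-cong (ℚ.toℚᵘ-fromℚᵘ x) (ℚ.toℚᵘ-fromℚᵘ y)) (ℚᵘ.≃-sym (ℚ.toℚᵘ-fromℚᵘ _))))

fromℚᵘ-homo-+ : ∀ x y → fromℚᵘ x ℚ.+ fromℚᵘ y ≡ fromℚᵘ (x ℚᵘ.+ y)
fromℚᵘ-homo-+ x y = ℚ.toℚᵘ-injective (ℚᵘ.≃-trans (ℚ.toℚᵘ-homo-+ (fromℚᵘ x) (fromℚᵘ y))
  (ℚᵘ.≃-trans (ℚᵘ.+-cong (ℚ.toℚᵘ-fromℚᵘ x) (ℚ.toℚᵘ-fromℚᵘ y)) (ℚᵘ.≃-sym (ℚ.toℚᵘ-fromℚᵘ _))))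

fromℤ : ℤ → ℚ
fromℤ z = z / 1

fromℕ : ℕ → ℚ
fromℕ n = fromℤ (+ n)

fromℤ-injective : ∀ {x y} → fromℤ x ≡ fromℤ y → x ≡ y
fromℤ-injective {x} {y} e = trans (sym (ℤ.*-identityʳ x))
  (trans (ℚᵘ.drop-*≡* (ℚ.fromℚᵘ-injective {mkℚᵘ x 0} {mkℚᵘ y 0} e)) (ℤ.*-identityʳ y))

fromℤ-* : ∀ x y → fromℤ (x ℤ.* y) ≡ fromℤ x ℚ.* fromℤ y
fromℤ-* x y = sym (fromℚᵘ-homo-* (mkℚᵘ x 0) (mkℚᵘ y 0))

fromℤ-+ : ∀ x y → fromℤ (x ℤ.+ y) ≡ fromℤ x ℚ.+ fromℤ y
fromℤ-+ x y = sym (trans (fromℚᵘ-homo-+ (mkℚᵘ x 0) (mkℚᵘ y 0))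
  (cong fromℤ (cong₂ ℤ._+_ (ℤ.*-identityʳ x) (ℤ.*-identityʳ y))))

fromℕ-* : ∀ m n → fromℕ (m ℕ.* n) ≡ fromℕ m ℚ.* fromℕ n
fromℕ-* m n = trans (cong fromℤ (ℤ.pos-* m n)) (fromℤ-* (+ m) (+ n))

/-cancel : ∀ z n → (z / suc n) ℚ.* fromℕ (suc n) ≡ fromℤ z
/-cancel z n = trans (fromℚᵘ-homo-* (mkℚᵘ z n) (mkℚᵘ (+ suc n) 0))
  (ℚ.fromℚᵘ-cong {mkℚᵘ z n ℚᵘ.* mkℚᵘ (+ suc n) 0} {mkℚᵘ z 0}
    (*≡* (trans (ℤ.*-identityʳ _) (cong (λ k → z ℤ.* + suc k) (sym (ℕ.*-identityʳ n))))))

-- Membership in ℤ₍₂₎, exhibited by an odd denominator that need not be the reduced one.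
record Integral₂ (q : ℚ) : Set where
  constructor integral
  field
    denominator  : ℕ
    numerator    : ℤ
    odd          : ¬ (2 ∣ denominator)
    q*den≡num    : q ℚ.* fromℕ denominator ≡ fromℤ numerator

2∤odd : ∀ n → ¬ (2 ∣ suc (2 ℕ.* n))
2∤odd n d with ∣1⇒≡1 (∣m+n∣m⇒∣n (subst (2 ∣_) (ℕ.+-comm 1 (2 ℕ.* n)) d) (m∣m*n n))
... | ()

2∤* : ∀ {m n} → ¬ (2 ∣ m) → ¬ (2 ∣ n) → ¬ (2 ∣ m ℕ.* n)
2∤* {m} {n} h k = [ h , k ]′ ∘ euclidsLemma m n prime[2]

integral-fromℤ : ∀ z → Integral₂ (fromℤ z)
integral-fromℤ z = integral 1 z (2∤odd 0) (ℚ.*-identityʳ (fromℤ z))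

integral-odd : ∀ z n → Integral₂ (z / suc (2 ℕ.* n))
integral-odd z n = integral (suc (2 ℕ.* n)) z (2∤odd n) (/-cancel z (2 ℕ.* n))

integral-+ : Integral₂ p → Integral₂ q → Integral₂ (p ℚ.+ q)
integral-+ {p} {q} (integral d x od hx) (integral e y oe hy) = integral (d ℕ.* e) (x ℤ.* + e ℤ.+ y ℤ.* + d) (2∤* od oe) (begin
  (p ℚ.+ q) ℚ.* fromℕ (d ℕ.* e)                                     ≡⟨ cong ((p ℚ.+ q) ℚ.*_) (fromℕ-* d e) ⟩
  (p ℚ.+ q) ℚ.* (fromℕ d ℚ.* fromℕ e)                               ≡⟨ solve 4 (λ p q d e → (p :+ q) :* (d :* e) := (p :* d) :* e :+ (q :* e) :* d) refl p q (fromℕ d) (fromℕ e) ⟩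
  (p ℚ.* fromℕ d) ℚ.* fromℕ e ℚ.+ (q ℚ.* fromℕ e) ℚ.* fromℕ d       ≡⟨ cong₂ (λ a b → a ℚ.* fromℕ e ℚ.+ b ℚ.* fromℕ d) hx hy ⟩
  fromℤ x ℚ.* fromℕ e ℚ.+ fromℤ y ℚ.* fromℕ d                       ≡⟨ cong₂ ℚ._+_ (fromℤ-* x (+ e)) (fromℤ-* y (+ d)) ⟨
  fromℤ (x ℤ.* + e) ℚ.+ fromℤ (y ℤ.* + d)                           ≡⟨ fromℤ-+ (x ℤ.* + e) (y ℤ.* + d) ⟨
  fromℤ (x ℤ.* + e ℤ.+ y ℤ.* + d) ∎)

integral-* : Integral₂ p → Integral₂ q → Integral₂ (p ℚ.* q)
integral-* {p} {q} (integral d x od hx) (integral e y oe hy) = integral (d ℕ.* e) (x ℤ.* y) (2∤* od oe) (begin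
  (p ℚ.* q) ℚ.* fromℕ (d ℕ.* e)                 ≡⟨ cong ((p ℚ.* q) ℚ.*_) (fromℕ-* d e) ⟩
  (p ℚ.* q) ℚ.* (fromℕ d ℚ.* fromℕ e)           ≡⟨ solve 4 (λ p q d e → (p :* q) :* (d :* e) := (p :* d) :* (q :* e)) refl p q (fromℕ d) (fromℕ e) ⟩
  (p ℚ.* fromℕ d) ℚ.* (q ℚ.* fromℕ e)           ≡⟨ cong₂ ℚ._*_ hx hy ⟩
  fromℤ x ℚ.* fromℤ y                           ≡⟨ fromℤ-* x y ⟨
  fromℤ (x ℤ.* y) ∎)

integral-pow : ∀ n → Integral₂ p → Integral₂ (powℚ p n)
integral-pow zero    h = integral-fromℤ (+ 1)
integral-pow (suc n) h = integral-* h (integral-pow n h)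

*-swapʳ : ∀ a b c → a ℚ.* b ℚ.* c ≡ a ℚ.* c ℚ.* b
*-swapʳ = solve 3 (λ a b c → a :* b :* c := a :* c :* b) refl

fromℤ-cross : ∀ {q r d z x} → q ℚ.* fromℤ r ≡ fromℤ z → q ℚ.* fromℤ d ≡ fromℤ x → z ℤ.* d ≡ x ℤ.* r
fromℤ-cross {q} {r} {d} {z} {x} qr≡z qd≡x = fromℤ-injective (begin
  fromℤ (z ℤ.* d)                ≡⟨ fromℤ-* z d ⟩
  fromℤ z ℚ.* fromℤ d            ≡⟨ cong (ℚ._* fromℤ d) qr≡z ⟨
  q ℚ.* fromℤ r ℚ.* fromℤ d      ≡⟨ *-swapʳ q (fromℤ r) (fromℤ d) ⟩
  q ℚ.* fromℤ d ℚ.* fromℤ r      ≡⟨ cong (ℚ._* fromℤ r) qd≡x ⟩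
  fromℤ x ℚ.* fromℤ r            ≡⟨ fromℤ-* x r ⟨
  fromℤ (x ℤ.* r) ∎)

↥-cross : ∀ q → q ℚ.* fromℕ (↧ₙ q) ≡ fromℤ (↥ q)
↥-cross q@(mkℚ z d-1 _) = trans (cong (ℚ._* fromℕ (suc d-1)) (sym (ℚ.↥p/↧p≡p q))) (/-cancel z d-1)

Zloc2⇒integral : Zloc2 q → Integral₂ q
Zloc2⇒integral {q} h = integral (↧ₙ q) (↥ q) h (↥-cross q)

↥↧-coprime : ∀ q → Coprime ∣ ↥ q ∣ (↧ₙ q)
↥↧-coprime (mkℚ _ _ c) = Coprime.recompute c

-- Cross multiplication gives `↥ q` · d = x · `↧ₙ q`. The reduced denominator is coprime to `↥ q`,
-- so it divides d, and if it were even then d would be even too.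
integral⇒Zloc2 : Integral₂ q → Zloc2 q
integral⇒Zloc2 {q} (integral d x od h) 2∣r = od (∣-trans 2∣r r∣d)
  where
  zd≡xr : ↥ q ℤ.* + d ≡ x ℤ.* + ↧ₙ q
  zd≡xr = fromℤ-cross {q} {+ ↧ₙ q} {+ d} {↥ q} {x} (↥-cross q) h

  r∣d : ↧ₙ q ∣ d
  r∣d = coprime-divisor {↧ₙ q} {∣ ↥ q ∣} {d} (Coprime.sym (↥↧-coprime q))
    (divides ∣ x ∣ (trans (sym (ℤ.abs-* (↥ q) (+ d))) (trans (cong ∣_∣ zd≡xr) (ℤ.abs-* x (+ ↧ₙ q)))))

-- Powers of two and factorials at the prime 2.

𝟚 : ℚ
𝟚 = (+ 2) / 1

powℚ-+ : ∀ q m n → powℚ q (m ℕ.+ n) ≡ powℚ q m ℚ.* powℚ q n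
powℚ-+ q zero    n = sym (ℚ.*-identityˡ _)
powℚ-+ q (suc m) n = trans (cong (q ℚ.*_) (powℚ-+ q m n)) (sym (ℚ.*-assoc q _ _))

powℚ-distrib : ∀ p q n → powℚ (p ℚ.* q) n ≡ powℚ p n ℚ.* powℚ q n
powℚ-distrib p q zero    = refl
powℚ-distrib p q (suc n) = trans (cong ((p ℚ.* q) ℚ.*_) (powℚ-distrib p q n))
  (solve 4 (λ p q a b → (p :* q) :* (a :* b) := (p :* a) :* (q :* b)) refl p q (powℚ p n) (powℚ q n))

powℚ-1 : ∀ n → powℚ 1ℚ n ≡ 1ℚ
powℚ-1 zero    = refl
powℚ-1 (suc n) = cong (1ℚ ℚ.*_) (powℚ-1 n)

powℚ-powℚ : ∀ q i n → powℚ (powℚ q i) n ≡ powℚ q (i ℕ.* n)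
powℚ-powℚ q zero    n = powℚ-1 n
powℚ-powℚ q (suc i) n = trans (powℚ-distrib q (powℚ q i) n)
  (trans (cong (powℚ q n ℚ.*_) (powℚ-powℚ q i n)) (sym (powℚ-+ q n (i ℕ.* n))))

2ⁿ½ⁿ≡1 : ∀ n → powℚ 𝟚 n ℚ.* powℚ ½ n ≡ 1ℚ
2ⁿ½ⁿ≡1 n = trans (sym (powℚ-distrib 𝟚 ½ n)) (powℚ-1 n)

2ᵏ½ˡ-integral : ∀ {k l} → l ≤ k → Integral₂ (powℚ 𝟚 k ℚ.* powℚ ½ l)
2ᵏ½ˡ-integral {k} {l} l≤k = subst Integral₂ (begin
    powℚ 𝟚 (k ℕ.∸ l)                                   ≡⟨ ℚ.*-identityʳ _ ⟨
    powℚ 𝟚 (k ℕ.∸ l) ℚ.* 1ℚ                            ≡⟨ cong (powℚ 𝟚 (k ℕ.∸ l) ℚ.*_) (2ⁿ½ⁿ≡1 l) ⟨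
    powℚ 𝟚 (k ℕ.∸ l) ℚ.* (powℚ 𝟚 l ℚ.* powℚ ½ l)       ≡⟨ ℚ.*-assoc (powℚ 𝟚 (k ℕ.∸ l)) _ _ ⟨
    powℚ 𝟚 (k ℕ.∸ l) ℚ.* powℚ 𝟚 l ℚ.* powℚ ½ l         ≡⟨ cong (ℚ._* powℚ ½ l) (powℚ-+ 𝟚 (k ℕ.∸ l) l) ⟨
    powℚ 𝟚 (k ℕ.∸ l ℕ.+ l) ℚ.* powℚ ½ l                ≡⟨ cong (λ j → powℚ 𝟚 j ℚ.* powℚ ½ l) (ℕ.m∸n+n≡m l≤k) ⟩
    powℚ 𝟚 k ℚ.* powℚ ½ l ∎)
  (integral-pow (k ℕ.∸ l) (integral-fromℤ (+ 2)))

invFact-! : ∀ n → invFact n ℚ.* fromℕ (n !) ≡ 1ℚ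
invFact-! zero    = refl
invFact-! (suc n) = begin
  (+ 1 / suc n) ℚ.* invFact n ℚ.* fromℕ (suc n ℕ.* n !)                 ≡⟨ cong ((+ 1 / suc n) ℚ.* invFact n ℚ.*_) (fromℕ-* (suc n) (n !)) ⟩
  (+ 1 / suc n) ℚ.* invFact n ℚ.* (fromℕ (suc n) ℚ.* fromℕ (n !))       ≡⟨ solve 4 (λ a b c d → a :* b :* (c :* d) := (a :* c) :* (b :* d)) refl (+ 1 / suc n) (invFact n) (fromℕ (suc n)) (fromℕ (n !)) ⟩
  (+ 1 / suc n) ℚ.* fromℕ (suc n) ℚ.* (invFact n ℚ.* fromℕ (n !))       ≡⟨ cong₂ ℚ._*_ (/-cancel (+ 1) n) (invFact-! n) ⟩
  1ℚ ∎

-- The quotient is the binomial coefficient (n + e) choose n.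
invFact-split : ∀ n e → Σ ℕ λ c → invFact n ≡ fromℕ c ℚ.* (fromℕ (e !) ℚ.* invFact (e ℕ.+ n))
invFact-split n e with [n∸k]!k!∣n! (ℕ.m≤m+n e n)
... | divides c eq = c , (begin
  invFact n                                                             ≡⟨ ℚ.*-identityʳ _ ⟨
  invFact n ℚ.* 1ℚ                                                      ≡⟨ cong (invFact n ℚ.*_) (invFact-! (e ℕ.+ n)) ⟨
  invFact n ℚ.* (invFact (e ℕ.+ n) ℚ.* fromℕ ((e ℕ.+ n) !))             ≡⟨ cong (λ x → invFact n ℚ.* (invFact (e ℕ.+ n) ℚ.* x)) fact-eq ⟩
  invFact n ℚ.* (invFact (e ℕ.+ n) ℚ.* (fromℕ c ℚ.* (fromℕ (n !) ℚ.* fromℕ (e !))))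
    ≡⟨ solve 5 (λ a b c d e → a :* (b :* (c :* (d :* e))) := (a :* d) :* (c :* (e :* b))) refl (invFact n) (invFact (e ℕ.+ n)) (fromℕ c) (fromℕ (n !)) (fromℕ (e !)) ⟩
  (invFact n ℚ.* fromℕ (n !)) ℚ.* (fromℕ c ℚ.* (fromℕ (e !) ℚ.* invFact (e ℕ.+ n)))
    ≡⟨ cong (ℚ._* (fromℕ c ℚ.* (fromℕ (e !) ℚ.* invFact (e ℕ.+ n)))) (invFact-! n) ⟩
  1ℚ ℚ.* (fromℕ c ℚ.* (fromℕ (e !) ℚ.* invFact (e ℕ.+ n)))              ≡⟨ ℚ.*-identityˡ _ ⟩
  fromℕ c ℚ.* (fromℕ (e !) ℚ.* invFact (e ℕ.+ n)) ∎)
  where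
  fact-eq : fromℕ ((e ℕ.+ n) !) ≡ fromℕ c ℚ.* (fromℕ (n !) ℚ.* fromℕ (e !))
  fact-eq = begin
    fromℕ ((e ℕ.+ n) !)                                  ≡⟨ cong fromℕ eq ⟩
    fromℕ (c ℕ.* ((e ℕ.+ n ℕ.∸ e) ! ℕ.* e !))            ≡⟨ cong (λ j → fromℕ (c ℕ.* (j ! ℕ.* e !))) (ℕ.m+n∸m≡n e n) ⟩
    fromℕ (c ℕ.* (n ! ℕ.* e !))                          ≡⟨ fromℕ-* c (n ! ℕ.* e !) ⟩
    fromℕ c ℚ.* fromℕ (n ! ℕ.* e !)                      ≡⟨ cong (fromℕ c ℚ.*_) (fromℕ-* (n !) (e !)) ⟩
    fromℕ c ℚ.* (fromℕ (n !) ℚ.* fromℕ (e !)) ∎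

parity : ∀ n → Σ ℕ λ k → n ≡ 2 ℕ.* k ⊎ n ≡ suc (2 ℕ.* k)
parity zero    = 0 , inj₁ refl
parity (suc n) with parity n
... | k , inj₁ eq = k , inj₂ (cong suc eq)
... | k , inj₂ eq = suc k , inj₁ (trans (cong suc eq) (sym (ℕ.*-suc 2 k)))

2ⁿ/n! : ℕ → ℚ
2ⁿ/n! n = powℚ 𝟚 n ℚ.* invFact n

2ⁿ/n!-suc : ∀ n → 2ⁿ/n! (suc n) ≡ 𝟚 ℚ.* (+ 1 / suc n) ℚ.* 2ⁿ/n! n
2ⁿ/n!-suc n = solve 4 (λ t a p i → (t :* p) :* (a :* i) := t :* a :* (p :* i)) refl 𝟚 (+ 1 / suc n) (powℚ 𝟚 n) (invFact n)

2/[2m+2] : ∀ m → 𝟚 ℚ.* (+ 1 / suc (suc (2 ℕ.* m))) ≡ + 1 / suc m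
2/[2m+2] m = trans (fromℚᵘ-homo-* (mkℚᵘ (+ 2) 0) (mkℚᵘ (+ 1) (suc (2 ℕ.* m))))
  (ℚ.fromℚᵘ-cong {mkℚᵘ (+ 2) 0 ℚᵘ.* mkℚᵘ (+ 1) (suc (2 ℕ.* m))} {mkℚᵘ (+ 1) m} (*≡* (cong +_ (begin
    2 ℕ.* suc m                               ≡⟨ ℕ.*-suc 2 m ⟩
    suc (suc (2 ℕ.* m))                       ≡⟨ ℕ.+-identityʳ _ ⟨
    suc (suc (2 ℕ.* m)) ℕ.+ 0                 ≡⟨ ℕ.+-identityʳ _ ⟨
    suc (suc (2 ℕ.* m)) ℕ.+ 0 ℕ.+ 0 ∎))))

-- (2m)! = 2ᵐ · m! · (2m-1)!!, and the double factorial is odd.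
1/[2m-1]!! : ℕ → ℚ
1/[2m-1]!! zero    = 1ℚ
1/[2m-1]!! (suc m) = (+ 1 / suc (2 ℕ.* m)) ℚ.* 1/[2m-1]!! m

1/[2m-1]!!-integral : ∀ m → Integral₂ (1/[2m-1]!! m)
1/[2m-1]!!-integral zero    = integral-fromℤ (+ 1)
1/[2m-1]!!-integral (suc m) = integral-* (integral-odd (+ 1) m) (1/[2m-1]!!-integral m)

2ⁿ/n!-double : ∀ m → 2ⁿ/n! (2 ℕ.* m) ≡ 1/[2m-1]!! m ℚ.* 2ⁿ/n! m
2ⁿ/n!-double zero = refl
2ⁿ/n!-double (suc m) = begin
  2ⁿ/n! (2 ℕ.* suc m)                              ≡⟨ cong 2ⁿ/n! (ℕ.*-suc 2 m) ⟩
  2ⁿ/n! (suc (suc (2 ℕ.* m)))                      ≡⟨ 2ⁿ/n!-suc (suc (2 ℕ.* m)) ⟩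
  𝟚 ℚ.* b ℚ.* 2ⁿ/n! (suc (2 ℕ.* m))                ≡⟨ cong (𝟚 ℚ.* b ℚ.*_) (2ⁿ/n!-suc (2 ℕ.* m)) ⟩
  𝟚 ℚ.* b ℚ.* (𝟚 ℚ.* a ℚ.* 2ⁿ/n! (2 ℕ.* m))        ≡⟨ cong₂ (λ x y → x ℚ.* (𝟚 ℚ.* a ℚ.* y)) (2/[2m+2] m) (2ⁿ/n!-double m) ⟩
  c ℚ.* (𝟚 ℚ.* a ℚ.* (u ℚ.* 2ⁿ/n! m))              ≡⟨ solve 5 (λ c t a u y → c :* (t :* a :* (u :* y)) := a :* u :* (t :* c :* y)) refl c 𝟚 a u (2ⁿ/n! m) ⟩
  a ℚ.* u ℚ.* (𝟚 ℚ.* c ℚ.* 2ⁿ/n! m)                ≡⟨ cong (a ℚ.* u ℚ.*_) (2ⁿ/n!-suc m) ⟨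
  a ℚ.* u ℚ.* 2ⁿ/n! (suc m) ∎
  where
  a = + 1 / suc (2 ℕ.* m)
  b = + 1 / suc (suc (2 ℕ.* m))
  c = + 1 / suc m
  u = 1/[2m-1]!! m

½-integral⇒integral : Integral₂ (½ ℚ.* q) → Integral₂ q
½-integral⇒integral {q} h = subst Integral₂ (trans (sym (ℚ.*-assoc 𝟚 ½ q)) (ℚ.*-identityˡ q)) (integral-* (integral-fromℤ (+ 2)) h)

-- By Legendre, the exponent of 2 in n! is n minus the number of binary ones of n, hence at most n -
-- 1. The induction peels off the last binary digit: from m to 2m the quotient changes by
-- 1/(2m-1)!!, and from 2m to 2m + 1 by 2/(2m + 1), whose 2 absorbs the ½ outright.
2ⁿ/n!-even : ∀ n → 0 < n → Integral₂ (½ ℚ.* 2ⁿ/n! n)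
2ⁿ/n!-even = <-rec _ step
  where
  half-double : ∀ m → Integral₂ (½ ℚ.* 2ⁿ/n! m) → Integral₂ (½ ℚ.* 2ⁿ/n! (2 ℕ.* m))
  half-double m h = subst Integral₂
    (trans (solve 3 (λ u h y → u :* (h :* y) := h :* (u :* y)) refl (1/[2m-1]!! m) ½ (2ⁿ/n! m))
      (cong (½ ℚ.*_) (sym (2ⁿ/n!-double m))))
    (integral-* (1/[2m-1]!!-integral m) h)

  half-odd : ∀ m → Integral₂ (2ⁿ/n! (2 ℕ.* m)) → Integral₂ (½ ℚ.* 2ⁿ/n! (suc (2 ℕ.* m)))
  half-odd m h = subst Integral₂ (begin
      a ℚ.* y                           ≡⟨ ℚ.*-identityˡ _ ⟨
      ½ ℚ.* 𝟚 ℚ.* (a ℚ.* y)             ≡⟨ solve 4 (λ h t a y → h :* t :* (a :* y) := h :* (t :* a :* y)) refl ½ 𝟚 a y ⟩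
      ½ ℚ.* (𝟚 ℚ.* a ℚ.* y)             ≡⟨ cong (½ ℚ.*_) (2ⁿ/n!-suc (2 ℕ.* m)) ⟨
      ½ ℚ.* 2ⁿ/n! (suc (2 ℕ.* m)) ∎)
    (integral-* (integral-odd (+ 1) m) h)
    where
    a = + 1 / suc (2 ℕ.* m)
    y = 2ⁿ/n! (2 ℕ.* m)

  step : ∀ n → (∀ {m} → m < n → 0 < m → Integral₂ (½ ℚ.* 2ⁿ/n! m)) → 0 < n → Integral₂ (½ ℚ.* 2ⁿ/n! n)
  step n rec 0<n with parity n
  step _ rec ()  | zero , inj₁ refl
  step _ rec 0<n | suc m , inj₁ refl = half-double (suc m) (rec (ℕ.m<m+n (suc m) z<s) z<s)
  -- For n = 1 the value to build on is 2⁰/0! = 1, which is not even; `half-odd` asks only for its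
  -- integrality.
  step _ rec 0<n | zero , inj₂ refl = half-odd zero (integral-fromℤ (+ 1))
  step _ rec 0<n | suc m , inj₂ refl = half-odd (suc m)
    (½-integral⇒integral (half-double (suc m) (rec (s≤s (ℕ.m≤m+n (suc m) _)) z<s)))

2ⁿ/n!-integral : ∀ n → Integral₂ (2ⁿ/n! n)
2ⁿ/n!-integral zero    = integral-fromℤ (+ 1)
2ⁿ/n!-integral (suc n) = ½-integral⇒integral (2ⁿ/n!-even (suc n) z<s)

-- Monomials up to trailing zeros, and their twist degree.

infix 4 _~_ _≋_

_~_ : Mono → Mono → Set
m ~ n = ∀ i → expo m i ≡ expo n i

~-sym : m ~ n → n ~ m
~-sym m~n i = sym (m~n i)

expo-normMono : ∀ m i → expo (normMono m) i ≡ expo m i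
expo-normMono []      i = refl
expo-normMono (e ∷ m) i with normMono m | expo-normMono m
expo-normMono (zero ∷ m)  zero    | []    | h = refl
expo-normMono (zero ∷ m)  (suc i) | []    | h = h i
expo-normMono (suc e ∷ m) zero    | []    | h = refl
expo-normMono (suc e ∷ m) (suc i) | []    | h = h i
expo-normMono (e ∷ m)     zero    | _ ∷ _ | h = refl
expo-normMono (e ∷ m)     (suc i) | _ ∷ _ | h = h i

normMono-zero : ∀ m → (∀ i → expo m i ≡ 0) → normMono m ≡ []
normMono-zero []      h = refl
normMono-zero (e ∷ m) h with normMono m | normMono-zero m (h ∘ suc) | h 0
... | .[] | refl | refl = refl

normMono-cong : ∀ m n → m ~ n → normMono m ≡ normMono n
normMono-cong []      n       h = sym (normMono-zero n (sym ∘ h))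
normMono-cong (e ∷ m) []      h = normMono-zero (e ∷ m) h
normMono-cong (e ∷ m) (f ∷ n) h with normMono m | normMono n | normMono-cong m n (h ∘ suc) | h 0
... | []    | .[]      | refl | refl = refl
... | x ∷ r | .(x ∷ r) | refl | refl = refl

does-true : ∀ {A : Set} (d : Dec A) → does d ≡ true → A
does-true (yes a) _ = a

~⇒sameMono : m ~ n → sameMono m n ≡ true
~⇒sameMono {m} {n} h = dec-true (List.≡-dec ℕ._≟_ (normMono m) (normMono n)) (normMono-cong m n h)

sameMono⇒~ : sameMono m n ≡ true → m ~ n
sameMono⇒~ {m} {n} h i = begin
  expo m i              ≡⟨ expo-normMono m i ⟨
  expo (normMono m) i   ≡⟨ cong (λ k → expo k i) (does-true (List.≡-dec ℕ._≟_ (normMono m) (normMono n)) h) ⟩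
  expo (normMono n) i   ≡⟨ expo-normMono n i ⟩
  expo n i ∎

expo-addMono : ∀ m n i → expo (addMono m n) i ≡ expo m i ℕ.+ expo n i
expo-addMono []      n       i       = refl
expo-addMono (e ∷ m) []      i       = sym (ℕ.+-identityʳ _)
expo-addMono (e ∷ m) (f ∷ n) zero    = refl
expo-addMono (e ∷ m) (f ∷ n) (suc i) = expo-addMono m n i

δ : ℕ → ℕ → ℕ
δ zero    zero    = 1
δ zero    (suc j) = 0
δ (suc i) zero    = 0
δ (suc i) (suc j) = δ i j

δ-diag : ∀ i → δ i i ≡ 1
δ-diag zero    = refl
δ-diag (suc i) = δ-diag i

expo-decAt : ∀ m i j → expo (decAt m i) j ≡ expo m j ℕ.∸ δ i j
expo-decAt []      i       j       = sym (ℕ.0∸n≡0 (δ i j))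
expo-decAt (e ∷ m) zero    zero    = refl
expo-decAt (e ∷ m) zero    (suc j) = refl
expo-decAt (e ∷ m) (suc i) zero    = refl
expo-decAt (e ∷ m) (suc i) (suc j) = expo-decAt m i j

addMono-congʳ : ∀ k → m ~ n → addMono k m ~ addMono k n
addMono-congʳ {m} {n} k h i = trans (expo-addMono k m i) (trans (cong (expo k i ℕ.+_) (h i)) (sym (expo-addMono k n i)))

decAt-cong : ∀ i → m ~ n → decAt m i ~ decAt n i
decAt-cong {m} {n} i h j = trans (expo-decAt m i j) (trans (cong (ℕ._∸ δ i j) (h j)) (sym (expo-decAt n i j)))

-- The exponent of 2 in the substitution p_(2i+1) ↦ 2^i p_(2i+1).
twistDeg : ℕ → Mono → ℕ
twistDeg i []      = 0
twistDeg i (e ∷ m) = i ℕ.* e ℕ.+ twistDeg (suc i) m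

twistFrom≡ : ∀ i m → twistFrom i m ≡ powℚ 𝟚 (twistDeg i m)
twistFrom≡ i []      = refl
twistFrom≡ i (e ∷ m) = trans (cong₂ ℚ._*_ (powℚ-powℚ 𝟚 i e) (twistFrom≡ (suc i) m)) (sym (powℚ-+ 𝟚 (i ℕ.* e) _))

twistDeg-zero : ∀ i m → (∀ j → expo m j ≡ 0) → twistDeg i m ≡ 0
twistDeg-zero i []      h = refl
twistDeg-zero i (e ∷ m) h = cong₂ ℕ._+_ (trans (cong (i ℕ.*_) (h 0)) (ℕ.*-zeroʳ i)) (twistDeg-zero (suc i) m (h ∘ suc))

twistDeg-cong : ∀ i m n → m ~ n → twistDeg i m ≡ twistDeg i n
twistDeg-cong i []      n       h = sym (twistDeg-zero i n (sym ∘ h))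
twistDeg-cong i (e ∷ m) []      h = twistDeg-zero i (e ∷ m) h
twistDeg-cong i (e ∷ m) (f ∷ n) h = cong₂ ℕ._+_ (cong (i ℕ.*_) (h 0)) (twistDeg-cong (suc i) m n (h ∘ suc))

twistDeg-addMono : ∀ i m n → twistDeg i (addMono m n) ≡ twistDeg i m ℕ.+ twistDeg i n
twistDeg-addMono i []      n       = refl
twistDeg-addMono i (e ∷ m) []      = sym (ℕ.+-identityʳ _)
twistDeg-addMono i (e ∷ m) (f ∷ n) = begin
  i ℕ.* (e ℕ.+ f) ℕ.+ twistDeg (suc i) (addMono m n)                            ≡⟨ cong₂ ℕ._+_ (ℕ.*-distribˡ-+ i e f) (twistDeg-addMono (suc i) m n) ⟩
  (i ℕ.* e ℕ.+ i ℕ.* f) ℕ.+ (twistDeg (suc i) m ℕ.+ twistDeg (suc i) n)         ≡⟨ +-interchange (i ℕ.* e) _ _ _ ⟩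
  (i ℕ.* e ℕ.+ twistDeg (suc i) m) ℕ.+ (i ℕ.* f ℕ.+ twistDeg (suc i) n) ∎

twistDeg-decAt : ∀ i j m {e} → expo m j ≡ suc e → twistDeg i m ≡ (i ℕ.+ j) ℕ.+ twistDeg i (decAt m j)
twistDeg-decAt i j       []      ()
twistDeg-decAt i zero    (e ∷ m) refl = begin
  i ℕ.* suc _ ℕ.+ t               ≡⟨ cong (ℕ._+ t) (ℕ.*-suc i _) ⟩
  i ℕ.+ i ℕ.* _ ℕ.+ t             ≡⟨ ℕ.+-assoc i _ t ⟩
  i ℕ.+ (i ℕ.* _ ℕ.+ t)           ≡⟨ cong (ℕ._+ (i ℕ.* _ ℕ.+ t)) (ℕ.+-identityʳ i) ⟨
  i ℕ.+ 0 ℕ.+ (i ℕ.* _ ℕ.+ t) ∎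
  where t = twistDeg (suc i) m
twistDeg-decAt i (suc j) (e ∷ m) h = begin
  i ℕ.* e ℕ.+ twistDeg (suc i) m                                   ≡⟨ cong (i ℕ.* e ℕ.+_) (twistDeg-decAt (suc i) j m h) ⟩
  i ℕ.* e ℕ.+ (suc i ℕ.+ j ℕ.+ t)                                  ≡⟨ cong (λ k → i ℕ.* e ℕ.+ (k ℕ.+ t)) (ℕ.+-suc i j) ⟨
  i ℕ.* e ℕ.+ (i ℕ.+ suc j ℕ.+ t)                                  ≡⟨ ℕ.+-assoc (i ℕ.* e) _ t ⟨
  i ℕ.* e ℕ.+ (i ℕ.+ suc j) ℕ.+ t                                  ≡⟨ cong (ℕ._+ t) (ℕ.+-comm (i ℕ.* e) _) ⟩
  i ℕ.+ suc j ℕ.+ i ℕ.* e ℕ.+ t                                    ≡⟨ ℕ.+-assoc (i ℕ.+ suc j) _ t ⟩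
  i ℕ.+ suc j ℕ.+ (i ℕ.* e ℕ.+ t) ∎
  where t = twistDeg (suc i) (decAt m j)

-- Equality of polynomials through linear functionals.

ev : (Mono → ℚ) → Poly → ℚ
ev K = foldr (λ t acc → proj₁ t ℚ.* K (proj₂ t) ℚ.+ acc) 0ℚ

-- Lists that differ in trailing zeros denote one monomial, so only such K define a functional on
-- polynomials. Coefficients are the case K = `indicator m`.
Respects~ : (Mono → ℚ) → Set
Respects~ K = ∀ {m n} → m ~ n → K m ≡ K n

-- Equality as polynomials, tested against all linear functionals rather than coefficients only.
record _≋_ (P Q : Poly) : Set where
  constructor equal
  field ev≡ : ∀ K → Respects~ K → ev K P ≡ ev K Q
open _≋_

≋-refl : P ≋ P
≋-refl .ev≡ K h = refl

≋-reflexive : P ≡ Q → P ≋ Q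
≋-reflexive refl = ≋-refl

≋-trans : P ≋ Q → Q ≋ R → P ≋ R
≋-trans p q .ev≡ K h = trans (ev≡ p K h) (ev≡ q K h)

ev-++ : ∀ K P Q → ev K (P ++ Q) ≡ ev K P ℚ.+ ev K Q
ev-++ K []            Q = sym (ℚ.+-identityˡ _)
ev-++ K ((c , m) ∷ P) Q = trans (cong (c ℚ.* K m ℚ.+_) (ev-++ K P Q)) (sym (ℚ.+-assoc (c ℚ.* K m) _ _))

ev-scale : ∀ K c P → ev K (scale c P) ≡ c ℚ.* ev K P
ev-scale K c []            = sym (ℚ.*-zeroʳ c)
ev-scale K c ((d , m) ∷ P) = trans (cong (c ℚ.* d ℚ.* K m ℚ.+_) (ev-scale K c P))
  (solve 4 (λ c d k x → c :* d :* k :+ c :* x := c :* (d :* k :+ x)) refl c d (K m) (ev K P))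

indicator : Mono → Mono → ℚ
indicator m n = if sameMono n m then 1ℚ else 0ℚ

indicator-resp : ∀ m → Respects~ (indicator m)
indicator-resp m {k} {n} k~n with sameMono k m in eqk | sameMono n m in eqn
... | true  | true  = refl
... | false | false = refl
... | true  | false with trans (sym eqn) (~⇒sameMono {n} {m} λ i → trans (sym (k~n i)) (sameMono⇒~ {k} {m} eqk i))
...   | ()
indicator-resp m {k} {n} k~n | false | true with trans (sym eqk) (~⇒sameMono {k} {m} λ i → trans (k~n i) (sameMono⇒~ {n} {m} eqn i))
...   | ()

coeff≡ev : ∀ P m → coeff P m ≡ ev (indicator m) P
coeff≡ev []            m = refl
coeff≡ev ((c , n) ∷ P) m with sameMono n m
... | true  = cong₂ ℚ._+_ (sym (ℚ.*-identityʳ c)) (coeff≡ev P m)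
... | false = trans (coeff≡ev P m) (sym (trans (cong (ℚ._+ _) (ℚ.*-zeroʳ c)) (ℚ.+-identityˡ _)))

≋⇒≈ : P ≋ Q → P ≈ Q
≋⇒≈ {P} {Q} h m = trans (coeff≡ev P m) (trans (ev≡ h (indicator m) (λ {k} {n} → indicator-resp m {k} {n})) (sym (coeff≡ev Q m)))

-- Collecting the terms of equal monomials.

remove : Mono → Poly → Poly
remove n = filter (λ t → T? (not (sameMono (proj₂ t) n)))

ev-remove : ∀ K → Respects~ K → ∀ n P → ev K P ≡ coeff P n ℚ.* K n ℚ.+ ev K (remove n P)
ev-remove K h n [] = sym (trans (ℚ.+-identityʳ _) (ℚ.*-zeroˡ (K n)))
ev-remove K h n ((c , m) ∷ P) with sameMono m n in eq
... | true  = begin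
  c ℚ.* K m ℚ.+ ev K P                                          ≡⟨ cong₂ (λ x y → c ℚ.* x ℚ.+ y) (h (sameMono⇒~ {m} {n} eq)) (ev-remove K h n P) ⟩
  c ℚ.* K n ℚ.+ (coeff P n ℚ.* K n ℚ.+ ev K (remove n P))       ≡⟨ solve 4 (λ c k d x → c :* k :+ (d :* k :+ x) := (c :+ d) :* k :+ x) refl c (K n) (coeff P n) (ev K (remove n P)) ⟩
  (c ℚ.+ coeff P n) ℚ.* K n ℚ.+ ev K (remove n P) ∎
... | false = trans (cong (c ℚ.* K m ℚ.+_) (ev-remove K h n P))
  (solve 3 (λ a b x → a :+ (b :+ x) := b :+ (a :+ x)) refl (c ℚ.* K m) (coeff P n ℚ.* K n) (ev K (remove n P)))

coeff-remove : ∀ n P m → coeff (remove n P) m ≡ (if sameMono m n then 0ℚ else coeff P m)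
coeff-remove n [] m with sameMono m n
... | true  = refl
... | false = refl
coeff-remove n ((c , k) ∷ P) m with sameMono k n in kn | sameMono m n in mn | coeff-remove n P m
... | true  | true  | ih = ih
... | true  | false | ih with sameMono k m in km
...   | false = ih
...   | true with trans (sym mn) (~⇒sameMono {m} {n} λ i → trans (sym (sameMono⇒~ {k} {m} km i)) (sameMono⇒~ {k} {n} kn i))
...     | ()
coeff-remove n ((c , k) ∷ P) m | false | true | ih with sameMono k m in km
...   | false = ih
...   | true with trans (sym kn) (~⇒sameMono {k} {n} λ i → trans (sameMono⇒~ {k} {m} km i) (sameMono⇒~ {m} {n} mn i))
...     | ()
coeff-remove n ((c , k) ∷ P) m | false | false | ih with sameMono k m
...   | true  = cong (c ℚ.+_) ih
...   | false = ih

-- Turns a property of coefficients into one of single terms: all terms on the monomial of the head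
-- are merged into one term carrying the total coefficient. The recursion runs on `remove n P′`,
-- which is no structural part of P, so l bounds the length as fuel. Removed monomials get
-- coefficient 0, which is why G must hold there.
collect : (G : ℚ × Mono → Set) → (∀ m → G (0ℚ , m)) →
  ∀ l P → length P ≤ l → (∀ m → G (coeff P m , m)) → Σ Poly λ X → P ≋ X × All G X
collect G G0 l       []              _         h = [] , ≋-refl , []
collect G G0 (suc l) P@((c , n) ∷ P′) (s≤s len) h
  with collect G G0 l (remove n P′) (ℕ.≤-trans (List.length-filter _ P′) len) rest-good
  where
  rest-good : ∀ m → G (coeff (remove n P′) m , m)
  rest-good m with sameMono m n in mn | coeff-remove n P′ m
  ... | true  | e = subst (λ x → G (x , m)) (sym e) (G0 m)
  ... | false | e with sameMono n m in nm | h m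
  ...   | false | g = subst (λ x → G (x , m)) (sym e) g
  ...   | true  | _ with trans (sym mn) (~⇒sameMono {m} {n} (~-sym {n} {m} (sameMono⇒~ {n} {m} nm)))
  ...     | ()
... | X , P≋X , gX = (coeff P n , n) ∷ X , equal eq , h n ∷ gX
  where
  remove-head : remove n P ≡ remove n P′
  remove-head rewrite ~⇒sameMono {n} {n} (λ _ → refl) = refl

  eq : ∀ K → Respects~ K → ev K P ≡ coeff P n ℚ.* K n ℚ.+ ev K X
  eq K hK = trans (ev-remove K hK n P) (cong (coeff P n ℚ.* K n ℚ.+_) (trans (cong (ev K) remove-head) (ev≡ P≋X K hK)))

-- The operators respect equality.

≋-++ : ∀ {P Q P′ Q′} → P ≋ P′ → Q ≋ Q′ → P ++ Q ≋ P′ ++ Q′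
≋-++ {P} {Q} {P′} {Q′} p q .ev≡ K h = trans (ev-++ K P Q) (trans (cong₂ ℚ._+_ (ev≡ p K h) (ev≡ q K h)) (sym (ev-++ K P′ Q′)))

≋-scale : ∀ c → P ≋ Q → scale c P ≋ scale c Q
≋-scale {P} {Q} c p .ev≡ K h = trans (ev-scale K c P) (trans (cong (c ℚ.*_) (ev≡ p K h)) (sym (ev-scale K c Q)))

≋-sumPoly : ∀ {A : Set} {f g : A → Poly} → (∀ x → f x ≋ g x) → ∀ xs → sumPoly (map f xs) ≋ sumPoly (map g xs)
≋-sumPoly h []       = ≋-refl
≋-sumPoly h (x ∷ xs) = ≋-++ (h x) (≋-sumPoly h xs)

ev-shift : ∀ K c m Q → ev K (map (λ t → (c ℚ.* proj₁ t , addMono m (proj₂ t))) Q) ≡ c ℚ.* ev (K ∘ addMono m) Q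
ev-shift K c m []            = sym (ℚ.*-zeroʳ c)
ev-shift K c m ((d , n) ∷ Q) = trans (cong (c ℚ.* d ℚ.* K (addMono m n) ℚ.+_) (ev-shift K c m Q))
  (solve 4 (λ c d k x → c :* d :* k :+ c :* x := c :* (d :* k :+ x)) refl c d (K (addMono m n)) (ev (K ∘ addMono m) Q))

≋-⊗ʳ : ∀ P → Q ≋ R → P ⊗ Q ≋ P ⊗ R
≋-⊗ʳ []            q = ≋-refl
≋-⊗ʳ {Q} {R} ((c , m) ∷ P) q = ≋-++ shift (≋-⊗ʳ P q)
  where
  shift : map (λ t → (c ℚ.* proj₁ t , addMono m (proj₂ t))) Q ≋ map (λ t → (c ℚ.* proj₁ t , addMono m (proj₂ t))) R
  shift .ev≡ K h = trans (ev-shift K c m Q)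
    (trans (cong (c ℚ.*_) (ev≡ q (K ∘ addMono m) (λ {k} {n} k~n → h (addMono-congʳ {k} {n} m k~n)))) (sym (ev-shift K c m R)))

-- The derivative is moved over to the functional, which makes congruence of `∂` a matter of
-- checking `Respects~`. Where `∂` drops a term the factor `expo n i` vanishes, so one formula
-- serves all terms.
ev-∂ : ∀ K i P → ev K (∂ i P) ≡ ev (λ n → fromℕ (expo n i) ℚ.* K (decAt n i)) P
ev-∂ K i []            = refl
ev-∂ K i ((c , m) ∷ P) with expo m i
... | zero  = trans (ev-∂ K i P) (sym (trans (cong (ℚ._+ _) (trans (cong (c ℚ.*_) (ℚ.*-zeroˡ (K (decAt m i)))) (ℚ.*-zeroʳ c))) (ℚ.+-identityˡ _)))
... | suc e = cong₂ ℚ._+_ (ℚ.*-assoc c (fromℕ (suc e)) (K (decAt m i))) (ev-∂ K i P)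

≋-∂ : ∀ i → P ≋ Q → ∂ i P ≋ ∂ i Q
≋-∂ {P} {Q} i p .ev≡ K h = trans (ev-∂ K i P) (trans (ev≡ p _ (λ {m} {n} → resp-∂ {m} {n})) (sym (ev-∂ K i Q)))
  where
  resp-∂ : Respects~ (λ n → fromℕ (expo n i) ℚ.* K (decAt n i))
  resp-∂ {m} {n} m~n = cong₂ (λ e x → fromℕ e ℚ.* x) (m~n i) (h (decAt-cong {m} {n} i m~n))

≋-∂^ : ∀ i n → P ≋ Q → ∂^ i n P ≋ ∂^ i n Q
≋-∂^ i zero    p = p
≋-∂^ i (suc n) p = ≋-∂ i (≋-∂^ i n p)

≋-∂multi : ∀ i m → P ≋ Q → ∂multi i m P ≋ ∂multi i m Q
≋-∂multi i []      p = p
≋-∂multi i (n ∷ m) p = ≋-∂^ i n (≋-∂multi (suc i) m p)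

≋-DOp : ∀ b → P ≋ Q → DOp b P ≋ DOp b Q
≋-DOp b p = ≋-sumPoly (λ m → ≋-scale (dFactor m) (≋-∂multi 0 m p)) (oddPartitions b)

-- Integrality of terms under products and derivatives.

-- Good s (c , m) says that c·m lies in s⁻¹Δ.
record Good (s : ℚ) (t : ℚ × Mono) : Set where
  constructor good
  field integrality : Integral₂ (s ℚ.* (proj₁ t ℚ.* powℚ ½ (twistDeg 0 (proj₂ t))))
open Good

good-scale : ∀ c → All (Good (s ℚ.* c)) P → All (Good s) (scale c P)
good-scale {s} c = All.map⁺ ∘ All.map λ { {d , m} (good h) → good (subst Integral₂
  (solve 4 (λ s c d x → s :* c :* (d :* x) := s :* (c :* d :* x)) refl s c d (powℚ ½ (twistDeg 0 m))) h) }

good-sumPoly : ∀ {A : Set} {f : A → Poly} {xs} → All (λ x → All (Good s) (f x)) xs → All (Good s) (sumPoly (map f xs))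
good-sumPoly []         = []
good-sumPoly (gx ∷ gxs) = All.++⁺ gx (good-sumPoly gxs)

-- Δ is a ring: `twistDeg` is additive on products of monomials, so the scalars simply multiply.
good-⊗ : All (Good s) P → All (Good r) Q → All (Good (s ℚ.* r)) (P ⊗ Q)
good-⊗ [] gQ = []
good-⊗ {s} {(c , m) ∷ P} {r} (good h ∷ gP) gQ = All.++⁺
  (All.map⁺ (All.map (λ { {d , n} (good g) → good (subst Integral₂ (eq d n) (integral-* h g)) }) gQ)) (good-⊗ gP gQ)
  where
  eq : ∀ d n → s ℚ.* (c ℚ.* powℚ ½ (twistDeg 0 m)) ℚ.* (r ℚ.* (d ℚ.* powℚ ½ (twistDeg 0 n)))
             ≡ s ℚ.* r ℚ.* (c ℚ.* d ℚ.* powℚ ½ (twistDeg 0 (addMono m n)))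
  eq d n = trans
    (solve 6 (λ s c x r d y → s :* (c :* x) :* (r :* (d :* y)) := s :* r :* (c :* d :* (x :* y))) refl
      s c (powℚ ½ (twistDeg 0 m)) r d (powℚ ½ (twistDeg 0 n)))
    (cong (λ x → s ℚ.* r ℚ.* (c ℚ.* d ℚ.* x))
      (trans (sym (powℚ-+ ½ (twistDeg 0 m) _)) (cong (powℚ ½) (sym (twistDeg-addMono 0 m n)))))

∂-All : ∀ {G H : ℚ × Mono → Set} i → (∀ c m e → expo m i ≡ suc e → G (c , m) → H (c ℚ.* fromℕ (suc e) , decAt m i)) →
  All G P → All H (∂ i P)
∂-All i step [] = []
∂-All {(c , m) ∷ P} i step (g ∷ gs) with expo m i | step c m
... | zero  | _ = ∂-All i step gs
... | suc e | f = f e refl g ∷ ∂-All i step gs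

½^twistDeg-decAt : ∀ m i {e} → expo m i ≡ suc e → powℚ ½ (twistDeg 0 m) ≡ powℚ ½ i ℚ.* powℚ ½ (twistDeg 0 (decAt m i))
½^twistDeg-decAt m i h = trans (cong (powℚ ½) (twistDeg-decAt 0 i m h)) (powℚ-+ ½ i _)

expo-decAt-self : ∀ m i {e} → expo m i ≡ suc e → expo (decAt m i) i ≡ e
expo-decAt-self m i h = trans (expo-decAt m i i) (cong₂ ℕ._∸_ h (δ-diag i))

-- p_1 is itself a generator of Δ, so removing one factor of it leaves the twist unchanged and
-- brings in only an integer.
good-∂₀ : All (Good s) P → All (Good s) (∂ 0 P)
good-∂₀ {s} = ∂-All 0 λ c m e h (good g) → good (subst Integral₂ (eq c m e h) (integral-* (integral-fromℤ (+ suc e)) g))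
  where
  eq : ∀ c m e → expo m 0 ≡ suc e → fromℕ (suc e) ℚ.* (s ℚ.* (c ℚ.* powℚ ½ (twistDeg 0 m)))
     ≡ s ℚ.* (c ℚ.* fromℕ (suc e) ℚ.* powℚ ½ (twistDeg 0 (decAt m 0)))
  eq c m e h = trans (cong (λ x → fromℕ (suc e) ℚ.* (s ℚ.* (c ℚ.* x))) (trans (½^twistDeg-decAt m 0 h) (ℚ.*-identityˡ _)))
    (solve 4 (λ n s c x → n :* (s :* (c :* x)) := s :* (c :* n :* x)) refl (fromℕ (suc e)) s c (powℚ ½ (twistDeg 0 (decAt m 0))))

-- After n derivatives the coefficient of a monomial with exponent e carries (e+n)!/e!, so dividing by n!
-- preserves integrality.
fallingWeight : ℕ → ℕ → ℚ
fallingWeight e n = fromℕ (e !) ℚ.* invFact (e ℕ.+ n)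

-- The weight is phrased in the exponent that remains, because the terms of `∂^ i n P` no longer
-- show the original one. A further derivative turns e + 1 into e and contributes the factor e + 1,
-- while (e + 1) + n = e + (n + 1); hence the number tested for integrality does not change at all.
good-∂^-falling : ∀ i n → All (Good s) P → All (λ t → Good (s ℚ.* powℚ ½ (i ℕ.* n) ℚ.* fallingWeight (expo (proj₂ t) i) n) t) (∂^ i n P)
good-∂^-falling {s} i zero = All.map λ { {c , m} (good g) → good (subst (λ x → Integral₂ (x ℚ.* (c ℚ.* powℚ ½ (twistDeg 0 m)))) (eq (expo m i)) g) }
  where
  eq : ∀ e → s ≡ s ℚ.* powℚ ½ (i ℕ.* 0) ℚ.* fallingWeight e 0
  eq e = begin
    s                                                ≡⟨ ℚ.*-identityʳ s ⟨
    s ℚ.* 1ℚ                                         ≡⟨ ℚ.*-identityʳ _ ⟨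
    s ℚ.* 1ℚ ℚ.* 1ℚ                                  ≡⟨ cong₂ (λ x y → s ℚ.* powℚ ½ x ℚ.* y) (ℕ.*-zeroʳ i) (trans (cong (λ x → fromℕ (e !) ℚ.* invFact x) (ℕ.+-identityʳ e)) (trans (ℚ.*-comm _ (invFact e)) (invFact-! e))) ⟨
    s ℚ.* powℚ ½ (i ℕ.* 0) ℚ.* fallingWeight e 0 ∎
good-∂^-falling {s} i (suc n) gP = ∂-All i (λ c m e h (good g) → good (subst Integral₂ (eq c m e h) g)) (good-∂^-falling i n gP)
  where
  eq : ∀ c m e → expo m i ≡ suc e →
       s ℚ.* powℚ ½ (i ℕ.* n) ℚ.* fallingWeight (expo m i) n ℚ.* (c ℚ.* powℚ ½ (twistDeg 0 m))
     ≡ s ℚ.* powℚ ½ (i ℕ.* suc n) ℚ.* fallingWeight (expo (decAt m i) i) (suc n) ℚ.* (c ℚ.* fromℕ (suc e) ℚ.* powℚ ½ (twistDeg 0 (decAt m i)))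
  eq c m e h = begin
    s ℚ.* B ℚ.* fallingWeight (expo m i) n ℚ.* (c ℚ.* powℚ ½ (twistDeg 0 m))
      ≡⟨ cong₂ (λ x y → s ℚ.* B ℚ.* fallingWeight x n ℚ.* (c ℚ.* y)) h (½^twistDeg-decAt m i h) ⟩
    s ℚ.* B ℚ.* (fromℕ (suc e ℕ.* e !) ℚ.* I) ℚ.* (c ℚ.* (powℚ ½ i ℚ.* D))
      ≡⟨ cong (λ x → s ℚ.* B ℚ.* (x ℚ.* I) ℚ.* (c ℚ.* (powℚ ½ i ℚ.* D))) (fromℕ-* (suc e) (e !)) ⟩
    s ℚ.* B ℚ.* (fromℕ (suc e) ℚ.* fromℕ (e !) ℚ.* I) ℚ.* (c ℚ.* (powℚ ½ i ℚ.* D))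
      ≡⟨ solve 8 (λ s b f e j c a d → s :* b :* (f :* e :* j) :* (c :* (a :* d)) := s :* (a :* b) :* (e :* j) :* (c :* f :* d)) refl
           s B (fromℕ (suc e)) (fromℕ (e !)) I c (powℚ ½ i) D ⟩
    s ℚ.* (powℚ ½ i ℚ.* B) ℚ.* (fromℕ (e !) ℚ.* I) ℚ.* (c ℚ.* fromℕ (suc e) ℚ.* D)
      ≡⟨ cong₂ (λ x y → s ℚ.* x ℚ.* (fromℕ (e !) ℚ.* invFact y) ℚ.* (c ℚ.* fromℕ (suc e) ℚ.* D))
           (trans (cong (powℚ ½) (ℕ.*-suc i n)) (powℚ-+ ½ i _)) (ℕ.+-suc e n) ⟨
    s ℚ.* powℚ ½ (i ℕ.* suc n) ℚ.* fallingWeight e (suc n) ℚ.* (c ℚ.* fromℕ (suc e) ℚ.* D)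
      ≡⟨ cong (λ x → s ℚ.* powℚ ½ (i ℕ.* suc n) ℚ.* fallingWeight x (suc n) ℚ.* (c ℚ.* fromℕ (suc e) ℚ.* D)) (expo-decAt-self m i h) ⟨
    s ℚ.* powℚ ½ (i ℕ.* suc n) ℚ.* fallingWeight (expo (decAt m i) i) (suc n) ℚ.* (c ℚ.* fromℕ (suc e) ℚ.* D) ∎
    where
    B = powℚ ½ (i ℕ.* n)
    I = invFact (suc e ℕ.+ n)
    D = powℚ ½ (twistDeg 0 (decAt m i))

-- Divided powers of a derivative act on monomials by binomial coefficients. Multiplying by that
-- integer trades the falling weight, which varies with the term, for the uniform 1/n!.
good-∂^ : ∀ i n → All (Good s) P → All (Good (s ℚ.* powℚ ½ (i ℕ.* n) ℚ.* invFact n)) (∂^ i n P)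
good-∂^ {s} i n gP = All.map (λ { {c , m} (good g) → good (subst Integral₂ (eq c m) (integral-* (integral-fromℤ (+ proj₁ (invFact-split n (expo m i)))) g)) }) (good-∂^-falling i n gP)
  where
  eq : ∀ c m → fromℕ (proj₁ (invFact-split n (expo m i))) ℚ.* (s ℚ.* powℚ ½ (i ℕ.* n) ℚ.* fallingWeight (expo m i) n ℚ.* (c ℚ.* powℚ ½ (twistDeg 0 m)))
     ≡ s ℚ.* powℚ ½ (i ℕ.* n) ℚ.* invFact n ℚ.* (c ℚ.* powℚ ½ (twistDeg 0 m))
  eq c m = trans (solve 5 (λ k s b w x → k :* (s :* b :* w :* x) := s :* b :* (k :* w) :* x) refl
      (fromℕ (proj₁ (invFact-split n (expo m i)))) s (powℚ ½ (i ℕ.* n)) (fallingWeight (expo m i) n) (c ℚ.* powℚ ½ (twistDeg 0 m)))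
    (cong (λ x → s ℚ.* powℚ ½ (i ℕ.* n) ℚ.* x ℚ.* (c ℚ.* powℚ ½ (twistDeg 0 m))) (sym (proj₂ (invFact-split n (expo m i)))))

-- p_(2i+1) ↦ p_(2i+1) + 2 z^-(2i+1) moves x = 2^i p_(2i+1) by 2^(i+1) z^-(2i+1): each derivative gains i + 1 factors 2.
good-∂multi : ∀ i m → All (Good s) P → All (Good (s ℚ.* (powℚ ½ (twistDeg i m ℕ.+ sum m) ℚ.* dFactor m))) (∂multi i m P)
good-∂multi {s} {P} i [] = subst (λ x → All (Good x) P) (sym (ℚ.*-identityʳ s))
good-∂multi {s} {P} i (n ∷ m) gP = subst (λ x → All (Good x) (∂multi i (n ∷ m) P)) eq (good-∂^ i n (good-∂multi (suc i) m gP))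
  where
  t = twistDeg (suc i) m
  X = powℚ ½ (t ℕ.+ sum m)
  Y = powℚ ½ (i ℕ.* n)

  eq : s ℚ.* (X ℚ.* dFactor m) ℚ.* Y ℚ.* invFact n
     ≡ s ℚ.* (powℚ ½ (i ℕ.* n ℕ.+ t ℕ.+ (n ℕ.+ sum m)) ℚ.* (powℚ 𝟚 n ℚ.* invFact n ℚ.* dFactor m))
  eq = begin
    s ℚ.* (X ℚ.* dFactor m) ℚ.* Y ℚ.* invFact n
      ≡⟨ ℚ.*-identityˡ _ ⟨
    1ℚ ℚ.* (s ℚ.* (X ℚ.* dFactor m) ℚ.* Y ℚ.* invFact n)
      ≡⟨ cong (ℚ._* (s ℚ.* (X ℚ.* dFactor m) ℚ.* Y ℚ.* invFact n)) (2ⁿ½ⁿ≡1 n) ⟨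
    powℚ 𝟚 n ℚ.* powℚ ½ n ℚ.* (s ℚ.* (X ℚ.* dFactor m) ℚ.* Y ℚ.* invFact n)
      ≡⟨ solve 7 (λ p q s x d y f → p :* q :* (s :* (x :* d) :* y :* f) := s :* ((y :* q :* x) :* (p :* f :* d))) refl
           (powℚ 𝟚 n) (powℚ ½ n) s X (dFactor m) Y (invFact n) ⟩
    s ℚ.* (Y ℚ.* powℚ ½ n ℚ.* X ℚ.* (powℚ 𝟚 n ℚ.* invFact n ℚ.* dFactor m))
      ≡⟨ cong (λ x → s ℚ.* (x ℚ.* (powℚ 𝟚 n ℚ.* invFact n ℚ.* dFactor m)))
           (trans (powℚ-+ ½ (i ℕ.* n ℕ.+ n) (t ℕ.+ sum m)) (cong (ℚ._* X) (powℚ-+ ½ (i ℕ.* n) n))) ⟨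
    s ℚ.* (powℚ ½ (i ℕ.* n ℕ.+ n ℕ.+ (t ℕ.+ sum m)) ℚ.* (powℚ 𝟚 n ℚ.* invFact n ℚ.* dFactor m))
      ≡⟨ cong (λ x → s ℚ.* (powℚ ½ x ℚ.* (powℚ 𝟚 n ℚ.* invFact n ℚ.* dFactor m))) (+-interchange (i ℕ.* n) n t (sum m)) ⟩
    s ℚ.* (powℚ ½ (i ℕ.* n ℕ.+ t ℕ.+ (n ℕ.+ sum m)) ℚ.* (powℚ 𝟚 n ℚ.* invFact n ℚ.* dFactor m)) ∎

-- Bounds at 2 for the coefficients of the two exponentials.

good-½^-≤ : ∀ {k l t} → k ≤ l → Good (s ℚ.* powℚ ½ l) t → Good (s ℚ.* powℚ ½ k) t
good-½^-≤ {s} {k} {l} {c , m} k≤l (good g) = good (subst Integral₂ eq (integral-* (2ᵏ½ˡ-integral k≤l) g))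
  where
  x = c ℚ.* powℚ ½ (twistDeg 0 m)
  eq : powℚ 𝟚 l ℚ.* powℚ ½ k ℚ.* (s ℚ.* powℚ ½ l ℚ.* x) ≡ s ℚ.* powℚ ½ k ℚ.* x
  eq = begin
    powℚ 𝟚 l ℚ.* powℚ ½ k ℚ.* (s ℚ.* powℚ ½ l ℚ.* x)
      ≡⟨ solve 5 (λ p q s h x → p :* q :* (s :* h :* x) := (p :* h) :* (s :* q :* x)) refl (powℚ 𝟚 l) (powℚ ½ k) s (powℚ ½ l) x ⟩
    powℚ 𝟚 l ℚ.* powℚ ½ l ℚ.* (s ℚ.* powℚ ½ k ℚ.* x)      ≡⟨ cong (ℚ._* (s ℚ.* powℚ ½ k ℚ.* x)) (2ⁿ½ⁿ≡1 l) ⟩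
    1ℚ ℚ.* (s ℚ.* powℚ ½ k ℚ.* x)                          ≡⟨ ℚ.*-identityˡ _ ⟩
    s ℚ.* powℚ ½ k ℚ.* x ∎

-- A part 2i + 1 contributes i to `twistDeg` and 1 to `sum`. This ties the degree in z to the two
-- counts that govern the powers of 2.
weightFrom≡ : ∀ i m → weightFrom i m ≡ 2 ℕ.* twistDeg i m ℕ.+ sum m
weightFrom≡ i []      = refl
weightFrom≡ i (e ∷ m) = trans (cong (suc (2 ℕ.* i) ℕ.* e ℕ.+_) (weightFrom≡ (suc i) m))
  (ℕSolver.solve 4 (λ i e t s → (con 1 :+ℕ con 2 :*ℕ i) :*ℕ e :+ℕ (con 2 :*ℕ t :+ℕ s) :=ℕ con 2 :*ℕ (i :*ℕ e :+ℕ t) :+ℕ (e :+ℕ s))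
    refl i e (twistDeg (suc i) m) (sum m))
  where open ℕSolver using (con) renaming (_:+_ to _:+ℕ_; _:*_ to _:*ℕ_; _:=_ to _:=ℕ_)

sum-pos : ∀ m → 0 < weight m → 0 < sum m
sum-pos m h with sum m in eq
... | suc _ = z<s
... | zero  = subst (0 <_) (trans (weightFrom≡ 0 m) (trans (cong (2 ℕ.* twistDeg 0 m ℕ.+_) eq) (trans (ℕ.+-identityʳ _) (cong (2 ℕ.*_) (twistDeg-zero 0 m (zero-expo m eq)))))) h
  where
  zero-expo : ∀ m → sum m ≡ 0 → ∀ j → expo m j ≡ 0
  zero-expo []         h j       = refl
  zero-expo (zero ∷ m) h zero    = refl
  zero-expo (zero ∷ m) h (suc j) = zero-expo m h j

oddPartitions-weight : ∀ n → All (λ m → weight m ≡ n) (oddPartitions n)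
oddPartitions-weight n = All.all-filter (λ m → weight m ℕ.≟ n) (vecs n n)

-- A partition m of b gains 2^(L + N) with L = `twistDeg 0 m` and N = `sum m`. Since b = 2L + N and
-- N > 0, one has 2(L + N) > b ≥ 2k, so at least k + 1 factors 2 are gained.
good-DOp : ∀ k b → 0 < b → 2 ℕ.* k ≤ b → All (Good s) P → All (Good (s ℚ.* powℚ ½ (suc k))) (DOp b P)
good-DOp {s} {P} k b 0<b 2k≤b gP =
  good-sumPoly {f = λ m → scale (dFactor m) (∂multi 0 m P)} (All.map (λ {m} → term {m}) (oddPartitions-weight b))
  where
  bound : ∀ m → weight m ≡ b → suc k ≤ twistDeg 0 m ℕ.+ sum m
  bound m refl = ℕ.*-cancelˡ-< 2 k (L ℕ.+ N) (≤.begin-strict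
    2 ℕ.* k                    ≤.≤⟨ 2k≤b ⟩
    weight m                   ≤.≡⟨ weightFrom≡ 0 m ⟩
    2 ℕ.* L ℕ.+ N              ≤.<⟨ ℕ.+-monoʳ-< (2 ℕ.* L) (ℕ.m<m*n N 2 {{ℕ.>-nonZero (sum-pos m 0<b)}} (s≤s z<s)) ⟩
    2 ℕ.* L ℕ.+ N ℕ.* 2        ≤.≡⟨ cong (2 ℕ.* L ℕ.+_) (ℕ.*-comm N 2) ⟩
    2 ℕ.* L ℕ.+ 2 ℕ.* N        ≤.≡⟨ ℕ.*-distribˡ-+ 2 L N ⟨
    2 ℕ.* (L ℕ.+ N) ≤.∎)
    where
    L = twistDeg 0 m
    N = sum m

  term : ∀ {m} → weight m ≡ b → All (Good (s ℚ.* powℚ ½ (suc k))) (scale (dFactor m) (∂multi 0 m P))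
  term {m} h = All.map (good-½^-≤ {s = s} (bound m h)) (good-scale {s ℚ.* powℚ ½ (twistDeg 0 m ℕ.+ sum m)} (dFactor m)
    (subst (λ x → All (Good x) (∂multi 0 m P)) (sym (ℚ.*-assoc s _ _)) (good-∂multi 0 m gP)))

-- Regroups the powers of 2 with the factorial, where they outweigh it; the base that is left has an
-- odd denominator.
hFactor-step : ∀ i e → powℚ (-[1+ 1 ] / suc (2 ℕ.* i)) e ℚ.* invFact e ≡ powℚ (-[1+ 0 ] / suc (2 ℕ.* i)) e ℚ.* 2ⁿ/n! e
hFactor-step i e = begin
  powℚ (-[1+ 1 ] / suc (2 ℕ.* i)) e ℚ.* invFact e             ≡⟨ cong (λ x → powℚ x e ℚ.* invFact e) factor ⟨
  powℚ (c ℚ.* 𝟚) e ℚ.* invFact e                              ≡⟨ cong (ℚ._* invFact e) (powℚ-distrib c 𝟚 e) ⟩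
  powℚ c e ℚ.* powℚ 𝟚 e ℚ.* invFact e                         ≡⟨ ℚ.*-assoc (powℚ c e) _ _ ⟩
  powℚ c e ℚ.* 2ⁿ/n! e ∎
  where
  c = -[1+ 0 ] / suc (2 ℕ.* i)

  factor : c ℚ.* 𝟚 ≡ -[1+ 1 ] / suc (2 ℕ.* i)
  factor = trans (fromℚᵘ-homo-* (mkℚᵘ -[1+ 0 ] (2 ℕ.* i)) (mkℚᵘ (+ 2) 0))
    (ℚ.fromℚᵘ-cong {mkℚᵘ -[1+ 0 ] (2 ℕ.* i) ℚᵘ.* mkℚᵘ (+ 2) 0} {mkℚᵘ -[1+ 1 ] (2 ℕ.* i)}
      (*≡* (cong (λ x → -[1+ 1 ] ℤ.* + suc x) (sym (ℕ.*-identityʳ (2 ℕ.* i))))))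

hFactor-step-integral : ∀ i e → Integral₂ (powℚ (-[1+ 1 ] / suc (2 ℕ.* i)) e ℚ.* invFact e)
hFactor-step-integral i e = subst Integral₂ (sym (hFactor-step i e)) (integral-* (integral-pow e (integral-odd -[1+ 0 ] i)) (2ⁿ/n!-integral e))

hFactor-integral : ∀ i m → Integral₂ (hFactor i m)
hFactor-integral i []      = integral-fromℤ (+ 1)
hFactor-integral i (e ∷ m) = integral-* (hFactor-step-integral i e) (hFactor-integral (suc i) m)

-- The first positive exponent supplies the factor 2; for the remaining ones integrality is enough.
hFactor-even : ∀ i m → 0 < sum m → Integral₂ (½ ℚ.* hFactor i m)
hFactor-even i (zero ∷ m) h = subst Integral₂ (cong (½ ℚ.*_) (sym (ℚ.*-identityˡ (hFactor (suc i) m)))) (hFactor-even (suc i) m h)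
hFactor-even i (e@(suc _) ∷ m) h = subst Integral₂ (begin
    powℚ c e ℚ.* (½ ℚ.* 2ⁿ/n! e) ℚ.* hFactor (suc i) m    ≡⟨ solve 4 (λ a h b x → a :* (h :* b) :* x := h :* (a :* b :* x)) refl (powℚ c e) ½ (2ⁿ/n! e) (hFactor (suc i) m) ⟩
    ½ ℚ.* (powℚ c e ℚ.* 2ⁿ/n! e ℚ.* hFactor (suc i) m)    ≡⟨ cong (λ x → ½ ℚ.* (x ℚ.* hFactor (suc i) m)) (hFactor-step i e) ⟨
    ½ ℚ.* hFactor i (e ∷ m) ∎)
  (integral-* (integral-* (integral-pow e (integral-odd -[1+ 0 ] i)) (2ⁿ/n!-even e z<s)) (hFactor-integral (suc i) m))
  where c = -[1+ 0 ] / suc (2 ℕ.* i)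

-- The ½ is the gain from `hFactor-even`. Rewriting a monomial in the generators of Δ costs 2^L with
-- L = `twistDeg 0 m`, and a = 2L + N with N > 0 forces 2L < a ≤ 2k + 2, that is L ≤ k.
good-hPoly : ∀ k a → 0 < a → a ≤ 2 ℕ.+ 2 ℕ.* k → All (Good (½ ℚ.* powℚ 𝟚 k)) (hPoly a)
good-hPoly k a 0<a a≤2k+2 = All.map⁺ (All.map term (oddPartitions-weight a))
  where
  bound : ∀ m → weight m ≡ a → twistDeg 0 m ≤ k
  bound m refl = ℕ.≤-pred (ℕ.*-cancelˡ-< 2 L (suc k) (≤.begin-strict
    2 ℕ.* L                    ≤.<⟨ ℕ.m<m+n (2 ℕ.* L) (sum-pos m 0<a) ⟩
    2 ℕ.* L ℕ.+ sum m          ≤.≡⟨ weightFrom≡ 0 m ⟨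
    weight m                   ≤.≤⟨ a≤2k+2 ⟩
    2 ℕ.+ 2 ℕ.* k              ≤.≡⟨ ℕ.*-suc 2 k ⟨
    2 ℕ.* suc k ≤.∎))
    where L = twistDeg 0 m

  term : ∀ {m} → weight m ≡ a → Good (½ ℚ.* powℚ 𝟚 k) (hFactor 0 m , m)
  term {m} refl = good (subst Integral₂
    (solve 4 (λ h f p q → h :* f :* (p :* q) := h :* p :* (f :* q)) refl ½ (hFactor 0 m) (powℚ 𝟚 k) (powℚ ½ (twistDeg 0 m)))
    (integral-* (hFactor-even 0 m (sum-pos m 0<a)) (2ᵏ½ˡ-integral (bound m refl))))

-- With k = ⌊b/2⌋ the factor 2ᵏ lost by h_a is regained from the factor 2ᵏ⁺¹ of DOp b; two factors 2 are left over.
good-product : ∀ a b → 0 < a → 0 < b → a ≤ suc b → All (Good 1ℚ) P → All (Good (½ ℚ.* ½)) (hPoly a ⊗ DOp b P)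
good-product {P} a b 0<a 0<b a≤1+b gP = subst (λ x → All (Good x) (hPoly a ⊗ DOp b P)) (scalar k)
  -- From b ≤ 2k + 1 follows a ≤ 2k + 2, the last degree at which the twist costs no more than 2ᵏ.
  (good-⊗ (good-hPoly k a 0<a (ℕ.≤-trans a≤1+b (s≤s b≤2k+1))) (good-DOp k b 0<b 2k≤b gP))
  where
  floor-half : ∀ b → Σ ℕ λ k → 2 ℕ.* k ≤ b × b ≤ suc (2 ℕ.* k)
  floor-half b with parity b
  ... | k , inj₁ refl = k , ℕ.≤-refl , ℕ.n≤1+n _
  ... | k , inj₂ refl = k , ℕ.n≤1+n _ , ℕ.≤-refl

  k = proj₁ (floor-half b)
  2k≤b = proj₁ (proj₂ (floor-half b))
  b≤2k+1 = proj₂ (proj₂ (floor-half b))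

  scalar : ∀ k → ½ ℚ.* powℚ 𝟚 k ℚ.* (1ℚ ℚ.* powℚ ½ (suc k)) ≡ ½ ℚ.* ½
  scalar k = begin
    ½ ℚ.* powℚ 𝟚 k ℚ.* (1ℚ ℚ.* (½ ℚ.* powℚ ½ k))       ≡⟨ solve 4 (λ h p o q → h :* p :* (o :* (h :* q)) := o :* (h :* h) :* (p :* q)) refl ½ (powℚ 𝟚 k) 1ℚ (powℚ ½ k) ⟩
    ½ ℚ.* ½ ℚ.* (powℚ 𝟚 k ℚ.* powℚ ½ k)                 ≡⟨ cong (½ ℚ.* ½ ℚ.*_) (2ⁿ½ⁿ≡1 k) ⟩
    ½ ℚ.* ½ ∎

-- The exceptional summands of `A (+ 1)` and `A -[1+ 0 ]`.

≋-termA : ∀ j b → P ≋ Q → termA j P b ≋ termA j Q b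
≋-termA j b p with (+ b) ℤ.- j
... | + a      = ≋-⊗ʳ (hPoly a) (≋-DOp b p)
... | -[1+ _ ] = ≋-refl

ev-hPoly₀⊗DOp₁ : ∀ K P → ev K (hPoly 0 ⊗ DOp 1 P) ≡ 𝟚 ℚ.* ev K (∂ 0 P)
ev-hPoly₀⊗DOp₁ K P = begin
  ev K (hPoly 0 ⊗ DOp 1 P)                  ≡⟨ cong (ev K) (List.++-identityʳ (map (λ t → (1ℚ ℚ.* proj₁ t , proj₂ t)) (DOp 1 P))) ⟩
  ev K (scale 1ℚ (DOp 1 P))                 ≡⟨ ev-scale K 1ℚ (DOp 1 P) ⟩
  1ℚ ℚ.* ev K (DOp 1 P)                     ≡⟨ ℚ.*-identityˡ _ ⟩
  -- `oddPartitions 1` evaluates to the single list `1 ∷ []`, whose `dFactor` is 2.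
  ev K (scale 𝟚 (∂ 0 P) ++ [])              ≡⟨ cong (ev K) (List.++-identityʳ (scale 𝟚 (∂ 0 P))) ⟩
  ev K (scale 𝟚 (∂ 0 P))                    ≡⟨ ev-scale K 𝟚 (∂ 0 P) ⟩
  𝟚 ℚ.* ev K (∂ 0 P) ∎

ev-hPoly₁⊗DOp₀ : ∀ K P → ev K (hPoly 1 ⊗ DOp 0 P) ≡ (ℚ.- 𝟚) ℚ.* ev K (var 0 ⊗ P)
ev-hPoly₁⊗DOp₀ K P = begin
  ev K (hPoly 1 ⊗ DOp 0 P)                                                          ≡⟨ cong (ev K) (List.++-identityʳ (map (λ t → ((ℚ.- 𝟚) ℚ.* proj₁ t , addMono (1 ∷ []) (proj₂ t))) (DOp 0 P))) ⟩
  ev K (map (λ t → ((ℚ.- 𝟚) ℚ.* proj₁ t , addMono (1 ∷ []) (proj₂ t))) (DOp 0 P))     ≡⟨ ev-shift K (ℚ.- 𝟚) (1 ∷ []) (DOp 0 P) ⟩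
  (ℚ.- 𝟚) ℚ.* ev K′ (DOp 0 P)                                                       ≡⟨ cong ((ℚ.- 𝟚) ℚ.*_) (begin
    ev K′ (scale 1ℚ P ++ [])            ≡⟨ cong (ev K′) (List.++-identityʳ (scale 1ℚ P)) ⟩
    ev K′ (scale 1ℚ P)                  ≡⟨ ev-scale K′ 1ℚ P ⟩
    1ℚ ℚ.* ev K′ P                      ≡⟨ ev-shift K 1ℚ (1 ∷ []) P ⟨
    ev K (map (λ t → (1ℚ ℚ.* proj₁ t , addMono (1 ∷ []) (proj₂ t))) P)   ≡⟨ cong (ev K) (List.++-identityʳ (map (λ t → (1ℚ ℚ.* proj₁ t , addMono (1 ∷ []) (proj₂ t))) P)) ⟨
    ev K (var 0 ⊗ P) ∎) ⟩
  (ℚ.- 𝟚) ℚ.* ev K (var 0 ⊗ P) ∎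
  where K′ = K ∘ addMono (1 ∷ [])

∂₀-maxWeight-zero : ∀ P → maxWeight P ≡ 0 → ∂ 0 P ≡ []
∂₀-maxWeight-zero [] h = refl
∂₀-maxWeight-zero ((c , m) ∷ P) h = trans (head m (ℕ.n≤0⇒n≡0 (subst (weight m ≤_) h (ℕ.m≤m⊔n (weight m) (maxWeight P)))))
    (∂₀-maxWeight-zero P (ℕ.n≤0⇒n≡0 (subst (maxWeight P ≤_) h (ℕ.m≤n⊔m (weight m) (maxWeight P)))))
  where
  head : ∀ m → weight m ≡ 0 → ∂ 0 ((c , m) ∷ P) ≡ ∂ 0 P
  head []           _ = refl
  head (zero ∷ m)   _ = refl

A₊-decomposition : ∀ {v X} → v ≋ X → All (Good 1ℚ) X →
  Σ Poly λ rest → All (Good (½ ℚ.* ½)) rest × A (+ 1) v ≋ scale 1ℚ (∂ 0 X) ⊕ scale ½ rest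
A₊-decomposition {v} {X} v≋X gX = split (maxWeight v) refl
  where
  split : ∀ B → maxWeight v ≡ B → Σ Poly λ rest → All (Good (½ ℚ.* ½)) rest ×
    scale ½ (sumPoly (map (termA (+ 1) v) (applyUpTo (λ x → x) (suc B)))) ≋ scale 1ℚ (∂ 0 X) ⊕ scale ½ rest
  -- The sum stops at b = 0, where a = -1, so the summand b = 1 that should yield the derivative is
  -- cut off. With `maxWeight v` zero the derivative vanishes as well.
  split zero    h = [] , [] , ≋-++ {[]} {[]} (≋-scale 1ℚ (≋-trans (≋-reflexive (sym (∂₀-maxWeight-zero v h))) (≋-∂ 0 v≋X))) ≋-refl
  -- b = 0 contributes nothing and b = 1 is split off; `rest` starts at b = 2, where a = b - 1 is
  -- positive.
  split (suc B) h = rest , good-sumPoly {f = termA (+ 1) X} (All.applyUpTo⁺₂ (λ b → suc (suc b)) B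
      (λ b → good-product (suc b) (suc (suc b)) z<s z<s (ℕ.≤-trans (ℕ.n≤1+n _) (ℕ.n≤1+n _)) gX)) ,
    ≋-trans (≋-scale ½ (≋-sumPoly (λ b → ≋-termA (+ 1) b v≋X) (applyUpTo (λ x → x) (suc (suc B))))) (equal eq)
    where
    rest = sumPoly (map (termA (+ 1) X) (applyUpTo (λ b → suc (suc b)) B))

    eq : ∀ K → Respects~ K → ev K (scale ½ (hPoly 0 ⊗ DOp 1 X ++ rest)) ≡ ev K (scale 1ℚ (∂ 0 X) ++ scale ½ rest)
    eq K _ = begin
      ev K (scale ½ (hPoly 0 ⊗ DOp 1 X ++ rest))          ≡⟨ ev-scale K ½ (hPoly 0 ⊗ DOp 1 X ++ rest) ⟩
      ½ ℚ.* ev K (hPoly 0 ⊗ DOp 1 X ++ rest)              ≡⟨ cong (½ ℚ.*_) (ev-++ K (hPoly 0 ⊗ DOp 1 X) rest) ⟩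
      ½ ℚ.* (ev K (hPoly 0 ⊗ DOp 1 X) ℚ.+ ev K rest)      ≡⟨ cong (λ x → ½ ℚ.* (x ℚ.+ ev K rest)) (ev-hPoly₀⊗DOp₁ K X) ⟩
      ½ ℚ.* (𝟚 ℚ.* ev K (∂ 0 X) ℚ.+ ev K rest)            ≡⟨ solve 4 (λ h t d r → h :* (t :* d :+ r) := (h :* t) :* d :+ h :* r) refl ½ 𝟚 (ev K (∂ 0 X)) (ev K rest) ⟩
      1ℚ ℚ.* ev K (∂ 0 X) ℚ.+ ½ ℚ.* ev K rest             ≡⟨ cong₂ ℚ._+_ (ev-scale K 1ℚ (∂ 0 X)) (ev-scale K ½ rest) ⟨
      ev K (scale 1ℚ (∂ 0 X)) ℚ.+ ev K (scale ½ rest)     ≡⟨ ev-++ K (scale 1ℚ (∂ 0 X)) (scale ½ rest) ⟨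
      ev K (scale 1ℚ (∂ 0 X) ++ scale ½ rest) ∎

-- Here a = b + 1, so the exceptional summand b = 0 lies within every cutoff and no case distinction
-- on `maxWeight v` arises.
A₋-decomposition : ∀ {v X} → v ≋ X → All (Good 1ℚ) X →
  Σ Poly λ rest → All (Good (½ ℚ.* ½)) rest × A -[1+ 0 ] v ≋ scale (ℚ.- 1ℚ) (var 0 ⊗ X) ⊕ scale ½ rest
A₋-decomposition {v} {X} v≋X gX = rest , good-sumPoly {f = termA -[1+ 0 ] X} (All.applyUpTo⁺₂ suc (maxWeight v)
      (λ b → good-product (suc b ℕ.+ 1) (suc b) z<s z<s (ℕ.≤-reflexive (ℕ.+-comm (suc b) 1)) gX)) ,
    ≋-trans (≋-scale ½ (≋-sumPoly (λ b → ≋-termA -[1+ 0 ] b v≋X) (applyUpTo (λ x → x) (suc (maxWeight v))))) (equal eq)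
  where
  rest = sumPoly (map (termA -[1+ 0 ] X) (applyUpTo suc (maxWeight v)))

  eq : ∀ K → Respects~ K → ev K (scale ½ (hPoly 1 ⊗ DOp 0 X ++ rest)) ≡ ev K (scale (ℚ.- 1ℚ) (var 0 ⊗ X) ++ scale ½ rest)
  eq K _ = begin
    ev K (scale ½ (hPoly 1 ⊗ DOp 0 X ++ rest))                       ≡⟨ ev-scale K ½ (hPoly 1 ⊗ DOp 0 X ++ rest) ⟩
    ½ ℚ.* ev K (hPoly 1 ⊗ DOp 0 X ++ rest)                           ≡⟨ cong (½ ℚ.*_) (ev-++ K (hPoly 1 ⊗ DOp 0 X) rest) ⟩
    ½ ℚ.* (ev K (hPoly 1 ⊗ DOp 0 X) ℚ.+ ev K rest)                   ≡⟨ cong (λ x → ½ ℚ.* (x ℚ.+ ev K rest)) (ev-hPoly₁⊗DOp₀ K X) ⟩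
    ½ ℚ.* ((ℚ.- 𝟚) ℚ.* ev K (var 0 ⊗ X) ℚ.+ ev K rest)               ≡⟨ solve 4 (λ h t d r → h :* (t :* d :+ r) := (h :* t) :* d :+ h :* r) refl ½ (ℚ.- 𝟚) (ev K (var 0 ⊗ X)) (ev K rest) ⟩
    (ℚ.- 1ℚ) ℚ.* ev K (var 0 ⊗ X) ℚ.+ ½ ℚ.* ev K rest                ≡⟨ cong₂ ℚ._+_ (ev-scale K (ℚ.- 1ℚ) (var 0 ⊗ X)) (ev-scale K ½ rest) ⟨
    ev K (scale (ℚ.- 1ℚ) (var 0 ⊗ X)) ℚ.+ ev K (scale ½ rest)        ≡⟨ ev-++ K (scale (ℚ.- 1ℚ) (var 0 ⊗ X)) (scale ½ rest) ⟨
    ev K (scale (ℚ.- 1ℚ) (var 0 ⊗ X) ++ scale ½ rest) ∎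

-- From coefficients in Δ to terms in Δ and back.

coeff-twist : ∀ q m → coeff (twist q) m ≡ coeff q m ℚ.* twistFrom 0 m
coeff-twist []            m = sym (ℚ.*-zeroˡ (twistFrom 0 m))
coeff-twist ((c , n) ∷ q) m with sameMono n m in eq
... | false = coeff-twist q m
... | true  = trans (cong₂ ℚ._+_ (cong (c ℚ.*_) twist-eq) (coeff-twist q m)) (sym (ℚ.*-distribʳ-+ (twistFrom 0 m) c (coeff q m)))
  where
  twist-eq : twistFrom 0 n ≡ twistFrom 0 m
  twist-eq = trans (twistFrom≡ 0 n) (trans (cong (powℚ 𝟚) (twistDeg-cong 0 n m (sameMono⇒~ {n} {m} eq))) (sym (twistFrom≡ 0 m)))

-- Dividing the coefficient of v at m by 2^(`twistDeg 0 m`) recovers the coefficient of q, so every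
-- collected term passes the test.
InΔ⇒good : ∀ {v} → InΔ v → Σ Poly λ X → v ≋ X × All (Good 1ℚ) X
InΔ⇒good {v} (q , hq , tq≈v) = collect (Good 1ℚ) zero-good (length v) v ℕ.≤-refl
    (λ m → good (subst Integral₂ (eq m) (Zloc2⇒integral (hq m))))
  where
  zero-good : ∀ m → Good 1ℚ (0ℚ , m)
  zero-good m = good (subst Integral₂ (sym (trans (ℚ.*-identityˡ _) (ℚ.*-zeroˡ (powℚ ½ (twistDeg 0 m))))) (integral-fromℤ (+ 0)))

  eq : ∀ m → coeff q m ≡ 1ℚ ℚ.* (coeff v m ℚ.* powℚ ½ (twistDeg 0 m))
  eq m = begin
    coeff q m                                                             ≡⟨ ℚ.*-identityʳ _ ⟨
    coeff q m ℚ.* 1ℚ                                                      ≡⟨ cong (coeff q m ℚ.*_) (2ⁿ½ⁿ≡1 (twistDeg 0 m)) ⟨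
    coeff q m ℚ.* (powℚ 𝟚 (twistDeg 0 m) ℚ.* powℚ ½ (twistDeg 0 m))       ≡⟨ ℚ.*-assoc (coeff q m) _ _ ⟨
    coeff q m ℚ.* powℚ 𝟚 (twistDeg 0 m) ℚ.* powℚ ½ (twistDeg 0 m)         ≡⟨ cong (λ x → coeff q m ℚ.* x ℚ.* powℚ ½ (twistDeg 0 m)) (twistFrom≡ 0 m) ⟨
    coeff q m ℚ.* twistFrom 0 m ℚ.* powℚ ½ (twistDeg 0 m)                 ≡⟨ cong (ℚ._* powℚ ½ (twistDeg 0 m)) (trans (sym (coeff-twist q m)) (tq≈v m)) ⟩
    coeff v m ℚ.* powℚ ½ (twistDeg 0 m)                                   ≡⟨ ℚ.*-identityˡ _ ⟨
    1ℚ ℚ.* (coeff v m ℚ.* powℚ ½ (twistDeg 0 m)) ∎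

coeff-integral : ∀ m → All (Integral₂ ∘ proj₁) P → Integral₂ (coeff P m)
coeff-integral m [] = integral-fromℤ (+ 0)
coeff-integral {(c , n) ∷ P} m (h ∷ hs) with sameMono n m
... | true  = integral-+ h (coeff-integral m hs)
... | false = coeff-integral m hs

untwist : Poly → Poly
untwist = map (λ t → (proj₁ t ℚ.* powℚ ½ (twistDeg 0 (proj₂ t)) , proj₂ t))

twist-untwist : ∀ P → twist (untwist P) ≡ P
twist-untwist []            = refl
twist-untwist ((c , m) ∷ P) = cong₂ _∷_ (cong (_, m) (begin
  c ℚ.* powℚ ½ (twistDeg 0 m) ℚ.* twistFrom 0 m                ≡⟨ cong (c ℚ.* powℚ ½ (twistDeg 0 m) ℚ.*_) (twistFrom≡ 0 m) ⟩
  c ℚ.* powℚ ½ (twistDeg 0 m) ℚ.* powℚ 𝟚 (twistDeg 0 m)        ≡⟨ solve 3 (λ c p q → c :* p :* q := c :* (q :* p)) refl c (powℚ ½ (twistDeg 0 m)) (powℚ 𝟚 (twistDeg 0 m)) ⟩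
  c ℚ.* (powℚ 𝟚 (twistDeg 0 m) ℚ.* powℚ ½ (twistDeg 0 m))      ≡⟨ cong (c ℚ.*_) (2ⁿ½ⁿ≡1 (twistDeg 0 m)) ⟩
  c ℚ.* 1ℚ                                                     ≡⟨ ℚ.*-identityʳ c ⟩
  c ∎)) (twist-untwist P)

good⇒InΔ : ∀ {v X} → v ≋ X → All (Good 1ℚ) X → InΔ v
good⇒InΔ {v} {X} v≋X gX = untwist X ,
  (λ m → integral⇒Zloc2 (coeff-integral m (All.map⁺ (All.map (λ { (good h) → subst Integral₂ (ℚ.*-identityˡ _) h }) gX)))) ,
  (λ m → trans (cong (λ P → coeff P m) (twist-untwist X)) (sym (≋⇒≈ v≋X m)))

-- Combination with `α₁` and `α₁*`, and the theorem.

good-quarter : ∀ z → All (Good (½ ℚ.* ½)) P → All (Good 1ℚ) (scale (fromℤ z ℚ.* (½ ℚ.* ½)) P)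
good-quarter z = good-scale {1ℚ} (fromℤ z ℚ.* (½ ℚ.* ½)) ∘ All.map λ { {c , m} (good g) → good (subst Integral₂
  (trans (sym (ℚ.*-assoc (fromℤ z) (½ ℚ.* ½) _)) (cong (ℚ._* (c ℚ.* powℚ ½ (twistDeg 0 m))) (sym (ℚ.*-identityˡ (fromℤ z ℚ.* (½ ℚ.* ½))))))
  (integral-* (integral-fromℤ z) g)) }

good-var₀⊗ : All (Good 1ℚ) P → All (Good 1ℚ) (var 0 ⊗ P)
good-var₀⊗ = good-⊗ {1ℚ} {var 0} {1ℚ} (good (integral-fromℤ (+ 1)) ∷ [])

-- In the applications u is the sign of `A` in the generator and w the sign with which `A` contains
-- D, so ½(1 + uw) is 1 or 0. The ½ of the generator and the ½ inside `A` make up the quarter in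
-- front of R.
half-sum : ∀ {P Q D R} u w → P ≋ D → Q ≋ scale w D ⊕ scale ½ R →
  scale ½ (P ⊕ scale u Q) ≋ scale (½ ℚ.* (1ℚ ℚ.+ u ℚ.* w)) D ⊕ scale (u ℚ.* (½ ℚ.* ½)) R
half-sum {P} {Q} {D} {R} u w p q .ev≡ K h = begin
  ev K (scale ½ (P ⊕ scale u Q))                                     ≡⟨ ev-scale K ½ (P ⊕ scale u Q) ⟩
  ½ ℚ.* ev K (P ⊕ scale u Q)                                         ≡⟨ cong (½ ℚ.*_) (trans (ev-++ K P (scale u Q)) (cong (ev K P ℚ.+_) (ev-scale K u Q))) ⟩
  ½ ℚ.* (ev K P ℚ.+ u ℚ.* ev K Q)                                    ≡⟨ cong₂ (λ x y → ½ ℚ.* (x ℚ.+ u ℚ.* y)) (ev≡ p K h)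
                                                                          (trans (ev≡ q K h) (trans (ev-++ K (scale w D) (scale ½ R)) (cong₂ ℚ._+_ (ev-scale K w D) (ev-scale K ½ R)))) ⟩
  ½ ℚ.* (ev K D ℚ.+ u ℚ.* (w ℚ.* ev K D ℚ.+ ½ ℚ.* ev K R))           ≡⟨ cong (λ x → ½ ℚ.* (x ℚ.+ u ℚ.* (w ℚ.* ev K D ℚ.+ ½ ℚ.* ev K R))) (ℚ.*-identityˡ (ev K D)) ⟨
  ½ ℚ.* (1ℚ ℚ.* ev K D ℚ.+ u ℚ.* (w ℚ.* ev K D ℚ.+ ½ ℚ.* ev K R))    ≡⟨ solve 6 (λ h o u w d r → h :* (o :* d :+ u :* (w :* d :+ h :* r)) := h :* (o :+ u :* w) :* d :+ u :* (h :* h) :* r) refl ½ 1ℚ u w (ev K D) (ev K R) ⟩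
  ½ ℚ.* (1ℚ ℚ.+ u ℚ.* w) ℚ.* ev K D ℚ.+ u ℚ.* (½ ℚ.* ½) ℚ.* ev K R   ≡⟨ cong₂ ℚ._+_ (ev-scale K (½ ℚ.* (1ℚ ℚ.+ u ℚ.* w)) D) (ev-scale K (u ℚ.* (½ ℚ.* ½)) R) ⟨
  ev K (scale (½ ℚ.* (1ℚ ℚ.+ u ℚ.* w)) D) ℚ.+ ev K (scale (u ℚ.* (½ ℚ.* ½)) R)   ≡⟨ ev-++ K (scale (½ ℚ.* (1ℚ ℚ.+ u ℚ.* w)) D) _ ⟨
  ev K (scale (½ ℚ.* (1ℚ ℚ.+ u ℚ.* w)) D ⊕ scale (u ℚ.* (½ ℚ.* ½)) R) ∎

≋-scale-1 : P ≋ scale 1ℚ P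
≋-scale-1 {P} .ev≡ K h = sym (trans (ev-scale K 1ℚ P) (ℚ.*-identityˡ _))

good-scale-ℤ : ∀ z → All (Good s) P → All (Good s) (scale (fromℤ z) P)
good-scale-ℤ {s} z = good-scale (fromℤ z) ∘ All.map λ { {c , m} (good g) → good (subst Integral₂
  (solve 3 (λ s z x → z :* (s :* x) := s :* z :* x) refl s (fromℤ z) (c ℚ.* powℚ ½ (twistDeg 0 m))) (integral-* (integral-fromℤ z) g)) }

half-sum-InΔ : ∀ {P Q D R} y z w → ½ ℚ.* (1ℚ ℚ.+ fromℤ z ℚ.* w) ≡ fromℤ y → P ≋ D → Q ≋ scale w D ⊕ scale ½ R →
  All (Good 1ℚ) D → All (Good (½ ℚ.* ½)) R → InΔ (scale ½ (P ⊕ scale (fromℤ z) Q))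
half-sum-InΔ {P} {Q} {D} {R} y z w eq p q gD gR = good⇒InΔ (half-sum (fromℤ z) w p q)
  (All.++⁺ (subst (λ x → All (Good 1ℚ) (scale x D)) (sym eq) (good-scale-ℤ y gD)) (good-quarter z gR))

InΔ-resp-≋ : P ≋ Q → InΔ Q → InΔ P
InΔ-resp-≋ p (q , hq , e) = q , hq , λ m → trans (e m) (sym (≋⇒≈ p m))

theorem3p4 : (v : Poly) → InΔ v → InΔ (e₀ v) × InΔ (e₁ v) × InΔ (f₀ v) × InΔ (f₁ v)
theorem3p4 v v∈Δ = stable-e₀ , stable-e₁ , stable-f₀ , stable-f₁
  where
  X : Poly
  X = proj₁ (InΔ⇒good {v} v∈Δ)

  v≋X : v ≋ X
  v≋X = proj₁ (proj₂ (InΔ⇒good {v} v∈Δ))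

  gX : All (Good 1ℚ) X
  gX = proj₂ (proj₂ (InΔ⇒good {v} v∈Δ))

  dec₊ = A₊-decomposition {v} {X} v≋X gX
  dec₋ = A₋-decomposition {v} {X} v≋X gX

  stable-e₀ : InΔ (e₀ v)
  -- `e₀` adds `A` without a scalar; the inserted `scale 1ℚ` gives it the shape that `half-sum-InΔ`
  -- expects.
  stable-e₀ = InΔ-resp-≋ (≋-scale ½ (≋-++ (≋-refl {α₁ v}) (≋-scale-1 {A (+ 1) v})))
    (half-sum-InΔ {α₁ v} {A (+ 1) v} (+ 1) (+ 1) 1ℚ refl (≋-∂ 0 v≋X) (proj₂ (proj₂ dec₊)) (good-∂₀ {P = X} gX) (proj₁ (proj₂ dec₊)))

  stable-e₁ : InΔ (e₁ v)
  stable-e₁ = half-sum-InΔ {α₁ v} {A (+ 1) v} (+ 0) -[1+ 0 ] 1ℚ refl (≋-∂ 0 v≋X) (proj₂ (proj₂ dec₊)) (good-∂₀ {P = X} gX) (proj₁ (proj₂ dec₊))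

  stable-f₀ : InΔ (f₀ v)
  stable-f₀ = half-sum-InΔ {α₁* v} {A -[1+ 0 ] v} (+ 1) -[1+ 0 ] (ℚ.- 1ℚ) refl (≋-⊗ʳ {v} {X} (var 0) v≋X) (proj₂ (proj₂ dec₋)) (good-var₀⊗ {X} gX) (proj₁ (proj₂ dec₋))

  stable-f₁ : InΔ (f₁ v)
  stable-f₁ = InΔ-resp-≋ (≋-scale ½ (≋-++ (≋-refl {α₁* v}) (≋-scale-1 {A -[1+ 0 ] v})))
    (half-sum-InΔ {α₁* v} {A -[1+ 0 ] v} (+ 0) (+ 1) (ℚ.- 1ℚ) refl (≋-⊗ʳ {v} {X} (var 0) v≋X) (proj₂ (proj₂ dec₋)) (good-var₀⊗ {X} gX) (proj₁ (proj₂ dec₋)))
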